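{- Let $G$ be a connected graph of order $n$ with chromatic number $\chi$. Then $$m_{D^{L}(G)}[n,n+2)\leq \chi-1.$$ The inequality is sharp: equality holds for all (connected) complete multipartite graphs.
   Context: All graphs are finite, simple and connected. For a connected graph $G$ with vertex set $\{v_1,\dots,v_n\}$, $d_{uv}$ is the length of a shortest path between $u$ and $v$, $D(G)=(d_{uv})$ is the distance matrix, $Tr(v)=\sum_{u\in V(G)}d_{uv}$ is the transmission of $v$, and the distance Laplacian matrix is $D^L(G)=\mathrm{diag}(Tr(v_1),\dots,Tr(v_n))-D(G)$. Its eigenvalues (all real) are the distance Laplacian eigenvalues of $G$. For an interval $I\subseteq\mathbb{R}$, $m_{D^L(G)}I$ denotes the number of distance Laplacian eigenvalues of $G$, counted with multiplicity, lying in $I$. -}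

module Defs where

open import Level using (Level; _⊔_; 0ℓ) renaming (suc to lsuc)
open import Data.Nat.Base as ℕ using (ℕ; zero; suc; z≤n; s≤s)
import Data.Nat.Properties as ℕ
open import Data.Fin.Base using (Fin)
open import Data.Fin.Properties using (_≟_; any?)
open import Data.List.Base using (List; []; _∷_)
open import Data.List.Relation.Unary.Unique.Propositional using (Unique)
open import Data.List.Relation.Unary.Unique.DecPropositional using (unique?)
open import Data.Product.Base using (Σ-syntax; ∃-syntax; _×_; _,_; proj₁; proj₂)
open import Data.Sum.Base using (_⊎_)
open import Data.Vec.Functional using (Vector)
open import Data.Bool.Base using (if_then_else_)
open import Function.Base using (_∘_)
open import Function.Bundles using (_⇔_)
open import Function.Definitions using (Surjective)
open import Relation.Binary.Core using (Rel)
open import Relation.Binary.Definitions using (Symmetric; Irreflexive)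
open import Relation.Binary.Structures using (IsStrictPartialOrder)
import Relation.Binary.Definitions as B
open import Relation.Binary.PropositionalEquality.Core using (_≡_; _≢_; refl; cong)
open import Relation.Nullary using (¬_; Dec; yes; no; does; contradiction)
open import Relation.Nullary.Decidable using (map′; _×-dec_)
open import Relation.Unary using (Pred; Decidable; _∈_)
open import Algebra.Apartness.Bundles using (HeytingField)
open import Algebra.Bundles using (CommutativeRing; Semiring)
import Algebra.Definitions.RawMonoid as RawMonoidDefs

------------------------------------------------------------------------
-- Graphs

record Graph (n : ℕ) : Set₁ where
  infix 4 _~_ _~?_
  field
    _~_      : Rel (Fin n) 0ℓ
    ~-sym    : Symmetric _~_
    ~-irrefl : Irreflexive _≡_ _~_
    _~?_     : B.Decidable _~_

module _ {n : ℕ} (G : Graph n) where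
  open Graph G

  data Walk : Fin n → Fin n → Set where
    []  : ∀ {u} → Walk u u
    _∷_ : ∀ {u w v} → u ~ w → Walk w v → Walk u v

  vertices : ∀ {u v} → Walk u v → List (Fin n)
  vertices {u} []      = u ∷ []
  vertices {u} (_ ∷ p) = u ∷ vertices p

  length : ∀ {u v} → Walk u v → ℕ
  length []      = 0
  length (_ ∷ p) = suc (length p)

  Path : Fin n → Fin n → Set
  Path u v = Σ[ p ∈ Walk u v ] Unique (vertices p)

  PathOfLength : Fin n → Fin n → ℕ → Set
  PathOfLength u v k = Σ[ p ∈ Path u v ] length (proj₁ p) ≡ k

  Connected : Set
  Connected = ∀ u v → Path u v

  IsProperColouring : ∀ {k} → (Fin n → Fin k) → Set
  IsProperColouring c = ∀ {u v} → u ~ v → c u ≢ c v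

  Colourable : ℕ → Set
  Colourable k = Σ[ c ∈ (Fin n → Fin k) ] IsProperColouring c

  IsChromaticNumber : ℕ → Set
  IsChromaticNumber χ = Colourable χ × (∀ k → Colourable k → χ ℕ.≤ k)

  -- Surjectivity says that all parts are nonempty.
  IsCompleteMultipartite : Set
  IsCompleteMultipartite =
    ∃[ k ] Σ[ part ∈ (Fin n → Fin k) ]
      Surjective _≡_ _≡_ part × (∀ u v → (u ~ v) ⇔ (part u ≢ part v))

------------------------------------------------------------------------
-- Graph distance

  private
    least : ∀ {P : Pred ℕ 0ℓ} → Decidable P → ∀ k → P k →
            ∃[ d ] P d × (∀ e → P e → d ℕ.≤ e)
    least P? k p with P? 0
    least P? k       p | yes p₀ = 0 , p₀ , λ _ _ → z≤n
    least P? zero    p | no ¬p₀ = contradiction p ¬p₀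
    least P? (suc k) p | no ¬p₀ with least (P? ∘ suc) k p
    ... | d , q , min = suc d , q , λ where
      zero    p₀ → contradiction p₀ ¬p₀
      (suc e) p′ → s≤s (min e p′)

    walk? : ∀ {Q : Pred (List (Fin n)) 0ℓ} → Decidable Q → ∀ k u v →
            Dec (Σ[ p ∈ Walk u v ] Q (vertices p) × length p ≡ k)
    walk? Q? zero u v with u ≟ v
    ... | no u≢v = no λ where
      ([] , _)           → u≢v refl
      ((_ ∷ _) , _ , ())
    ... | yes refl = map′
      (λ q → [] , q , refl)
      (λ { ([] , q , _) → q ; ((_ ∷ _) , _ , ()) })
      (Q? (u ∷ []))
    walk? Q? (suc k) u v = map′
      (λ { (w , e , p , q , l) → e ∷ p , q , cong suc l })
      (λ { ([] , _ , ()) ; (_∷_ {w = w} e p , q , l) → w , e , p , q , ℕ.suc-injective l })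
      (any? λ w → (u ~? w) ×-dec walk? (Q? ∘ (u ∷_)) k w v)

    pathOfLength? : ∀ u v → Decidable (PathOfLength u v)
    pathOfLength? u v k = map′
      (λ { (p , q , l) → (p , q) , l })
      (λ { ((p , q) , l) → p , q , l })
      (walk? (unique? _≟_) k u v)

  shortestPath : Connected → ∀ u v →
    ∃[ d ] PathOfLength u v d × (∀ e → PathOfLength u v e → d ℕ.≤ e)
  shortestPath conn u v =
    least (pathOfLength? u v) (length (proj₁ (conn u v))) (conn u v , refl)

  dist : Connected → Fin n → Fin n → ℕ
  dist conn u v = proj₁ (shortestPath conn u v)

------------------------------------------------------------------------
-- The real numbers

-- An Archimedean, Cauchy complete ordered field. Classically this
-- determines the field of real numbers up to isomorphism. The axioms use
-- the apartness relation x # y (x < y or y < x) and do not decide the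
-- order, so constructively defined reals are a model as well.

record RealNumbers c ℓ₁ ℓ₂ ℓ₃ : Set (lsuc (c ⊔ ℓ₁ ⊔ ℓ₂ ⊔ ℓ₃)) where
  field
    heytingField : HeytingField c ℓ₁ ℓ₂

  open HeytingField heytingField public

  commutativeRing : CommutativeRing c ℓ₁
  commutativeRing = record { isCommutativeRing = isCommutativeRing }

  open CommutativeRing commutativeRing public using (semiring)
  open RawMonoidDefs (Semiring.+-rawMonoid semiring) public
    using (sum) renaming (_×_ to _·_)

  fromℕ : ℕ → Carrier
  fromℕ n = n · 1#

  infix 4 _<_ _≤_
  field
    _<_                    : Rel Carrier ℓ₃
    <-isStrictPartialOrder : IsStrictPartialOrder _≈_ _<_
    #⇔<⊎>                  : ∀ x y → (x # y) ⇔ (x < y ⊎ y < x)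
    +-monoˡ-<              : ∀ {x y} z → x < y → x + z < y + z
    *-pos                  : ∀ {x y} → 0# < x → 0# < y → 0# < x * y

  _≤_ : Rel Carrier ℓ₃
  x ≤ y = ¬ (y < x)

  IsCauchy : (ℕ → Carrier) → Set (c ⊔ ℓ₃)
  IsCauchy s = ∀ ε → 0# < ε →
    ∃[ N ] (∀ i j → N ℕ.≤ i → N ℕ.≤ j → s i < s j + ε)

  _ConvergesTo_ : (ℕ → Carrier) → Carrier → Set (c ⊔ ℓ₃)
  s ConvergesTo l = ∀ ε → 0# < ε →
    ∃[ N ] (∀ i → N ℕ.≤ i → s i < l + ε × l < s i + ε)

  field
    archimedean : ∀ x → ∃[ n ] x < fromℕ n
    complete    : ∀ s → IsCauchy s → ∃[ l ] s ConvergesTo l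

------------------------------------------------------------------------
-- Eigenvalues of real matrices

module Spectral {c ℓ₁ ℓ₂ ℓ₃} (ℝ : RealNumbers c ℓ₁ ℓ₂ ℓ₃) where
  open RealNumbers ℝ

  Matrix : ℕ → Set c
  Matrix n = Fin n → Fin n → Carrier

  [_,_⟩ : Carrier → Carrier → Pred Carrier ℓ₃
  [ a , b ⟩ x = a ≤ x × x < b

  module _ {n : ℕ} where

    infix 4 _≋_
    _≋_ : Rel (Vector Carrier n) ℓ₁
    x ≋ y = ∀ i → x i ≈ y i

    0ᵥ : Vector Carrier n
    0ᵥ _ = 0#

    infixr 7 _*ᵥ_ _•_
    _*ᵥ_ : Matrix n → Vector Carrier n → Vector Carrier n
    (M *ᵥ x) i = sum (λ j → M i j * x j)

    _•_ : Carrier → Vector Carrier n → Vector Carrier n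
    (a • x) i = a * x i

    combination : ∀ {k} → Vector Carrier k → (Fin k → Vector Carrier n) → Vector Carrier n
    combination a b i = sum (λ j → a j * b j i)

    LinearlyIndependent : ∀ {k} → (Fin k → Vector Carrier n) → Set (c ⊔ ℓ₁)
    LinearlyIndependent b = ∀ a → combination a b ≋ 0ᵥ → ∀ j → a j ≈ 0#

    IsBasisOf : ∀ {ℓ k} → Pred (Vector Carrier n) ℓ → (Fin k → Vector Carrier n) →
                Set (c ⊔ ℓ₁ ⊔ ℓ)
    IsBasisOf V b =
      (∀ j → b j ∈ V) ×
      LinearlyIndependent b ×
      (∀ x → x ∈ V → ∃[ a ] x ≋ combination a b)

    HasDimension : ∀ {ℓ} → Pred (Vector Carrier n) ℓ → ℕ → Set (c ⊔ ℓ₁ ⊔ ℓ)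
    HasDimension V k = ∃[ b ] IsBasisOf {k = k} V b

    Eigenspace : Matrix n → Carrier → Pred (Vector Carrier n) ℓ₁
    Eigenspace M λ′ x = M *ᵥ x ≋ λ′ • x

    IsEigenvalue : Matrix n → Carrier → Set (c ⊔ ℓ₁ ⊔ ℓ₂)
    IsEigenvalue M λ′ = ∃[ x ] x ∈ Eigenspace M λ′ × ∃[ i ] x i # 0#

    -- The multiplicity of an eigenvalue is the dimension of its eigenspace.
    -- For the symmetric matrices considered here this is also its
    -- multiplicity as a root of the characteristic polynomial.
    HasMultiplicity : Matrix n → Carrier → ℕ → Set (c ⊔ ℓ₁)
    HasMultiplicity M λ′ = HasDimension (Eigenspace M λ′)

    -- m is the number of eigenvalues of M in I, counted with multiplicity:
    -- ev lists the distinct eigenvalues in I, mult their multiplicities.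
    CountsEigenvalues : ∀ {ℓ} → Matrix n → Pred Carrier ℓ → ℕ → Set (c ⊔ ℓ₁ ⊔ ℓ₂ ⊔ ℓ)
    CountsEigenvalues M I m =
      ∃[ r ] Σ[ ev ∈ Vector Carrier r ] Σ[ mult ∈ Vector ℕ r ]
        (∀ i j → i ≢ j → ev i # ev j) ×
        (∀ i → IsEigenvalue M (ev i) × ev i ∈ I) ×
        (∀ μ → IsEigenvalue M μ → μ ∈ I → ∃[ i ] μ ≈ ev i) ×
        (∀ i → HasMultiplicity M (ev i) (mult i)) ×
        m ≡ RawMonoidDefs.sum ℕ.+-0-rawMonoid mult

------------------------------------------------------------------------
-- The distance Laplacian

  module _ {n : ℕ} (G : Graph n) (conn : Connected G) where

    distanceMatrix : Matrix n
    distanceMatrix u v = fromℕ (dist G conn u v)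

    transmission : Fin n → Carrier
    transmission v = sum (λ u → distanceMatrix u v)

    diag : Vector Carrier n → Matrix n
    diag t i j = if does (i ≟ j) then t i else 0#

    distanceLaplacian : Matrix n
    distanceLaplacian i j = diag transmission i j - distanceMatrix i j

{-# OPTIONS --safe #-}
-- Fix a proper colouring of G and let N v be the size of the colour class of
-- v. Two distinct vertices of the same colour have distance at least 2, so
--   (D x) v = (n x_v - Σ x) + (N v x_v - Σ_{class of v} x) + (L x) v
-- with L the Laplacian of nonnegative weights, hence positive semidefinite.
-- If x sums to 0 over every class then x_v = 0 whenever N v = 1, and therefore
-- ⟨x , D x⟩ ≥ (n + 2) ⟨x , x⟩. Eigenvectors for eigenvalues in [n , n + 2) are
-- orthogonal to the constants, so on their span vanishing of the class sums
-- is only χ - 1 conditions; with χ or more of them some nonzero combination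
-- would satisfy all conditions, although ⟨x , D x⟩ < (n + 2) ⟨x , x⟩ there.
-- For complete multipartite graphs L = 0, and the eigenspace of n consists of
-- the vectors of sum 0 which are constant on the parts.
module Submission where

open import Defs
open import Data.Product.Base using (_×_)
open import Level using (Level)

open import Algebra.Bundles using (CommutativeRing)
import Algebra.Definitions.RawMonoid as RawMonoidDefs
import Algebra.Apartness.Properties.HeytingCommutativeRing as HeytingProperties
import Algebra.Properties.CommutativeSemigroup as CommutativeSemigroupProperties
import Algebra.Properties.Monoid.Mult as Mult
import Algebra.Properties.Ring as RingProperties
import Algebra.Properties.Semiring.Sum as SumProperties
open import Data.Bool.Base using (if_then_else_)
open import Data.Fin.Base using (Fin; zero; suc; punchIn; punchOut; splitAt; _↑ˡ_; _↑ʳ_)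
open import Data.Fin.Properties using (_≟_; any?; punchInᵢ≢i; punchOut-punchIn; punchIn-punchOut
  ; splitAt-↑ˡ; splitAt-↑ʳ; splitAt⁻¹-↑ˡ; splitAt⁻¹-↑ʳ; injective⇒≤)
open import Data.Nat.Base as ℕ using (ℕ; zero; suc; z≤n; s≤s)
import Data.Nat.Properties as ℕ
open import Data.Product.Base using (Σ; ∃-syntax; _,_; proj₁; proj₂)
open import Data.Sum.Base using (_⊎_; inj₁; inj₂)
open import Data.Vec.Functional using (Vector; removeAt)
open import Data.List.Base using (_++_; []; _∷_)
open import Data.List.Relation.Binary.Permutation.Propositional
  using (_↭_; ↭-refl; ↭-trans; ↭-sym; prep; ↭⇒↭ₛ)
open import Data.List.Relation.Binary.Permutation.Propositional.Properties using (shift; drop-∷; ++-comm)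
import Data.List.Relation.Binary.Permutation.Setoid.Properties as Permutation
import Data.List.Relation.Unary.All as All
import Data.List.Relation.Unary.AllPairs as AllPairs
open import Function.Base using (_∘_; flip)
open import Function.Bundles using (_⇔_; module Equivalence)
open import Relation.Binary.PropositionalEquality as ≡ using (_≡_; _≢_)
import Relation.Binary.Reasoning.Setoid as SetoidReasoning
open import Relation.Binary.Structures using (IsStrictPartialOrder)
open import Relation.Nullary using (¬_; Dec; yes; no; does; contradiction)
open import Relation.Nullary.Decidable using (_×-dec_; ¬?; decidable-stable)
open import Relation.Unary using (_∈_)

-- Kronecker symbol and indexing of disjoint unions of finite sets.

kronecker : ∀ {k} → Fin k → Fin k → ℕ
kronecker i j = if does (i ≟ j) then 1 else 0

kronecker-≡ : ∀ {k} {i j : Fin k} → i ≡ j → kronecker i j ≡ 1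
kronecker-≡ {i = i} {j} i≡j with i ≟ j
... | yes _  = ≡.refl
... | no i≢j = contradiction i≡j i≢j

kronecker-≢ : ∀ {k} {i j : Fin k} → i ≢ j → kronecker i j ≡ 0
kronecker-≢ {i = i} {j} i≢j with i ≟ j
... | yes i≡j = contradiction i≡j i≢j
... | no _    = ≡.refl

kronecker-sym : ∀ {k} (i j : Fin k) → kronecker i j ≡ kronecker j i
kronecker-sym i j with i ≟ j
... | yes i≡j    = ≡.sym (kronecker-≡ (≡.sym i≡j))
... | no i≢j     = ≡.sym (kronecker-≢ (i≢j ∘ ≡.sym))

∑ : ∀ {r} → Vector ℕ r → ℕ
∑ = RawMonoidDefs.sum ℕ.+-0-rawMonoid

-- With `split` a bijection between the pairs `(i , j)`, `j : Fin (k i)`, and `Fin (∑ k)`. It lets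
-- bases of several eigenspaces be read as one family.
join : ∀ {r} (k : Vector ℕ r) i → Fin (k i) → Fin (∑ k)
join k zero    j = j ↑ˡ _
join k (suc i) j = k zero ↑ʳ join (k ∘ suc) i j

split : ∀ {r} (k : Vector ℕ r) → Fin (∑ k) → Σ (Fin r) (Fin ∘ k)
split {suc r} k p with splitAt (k zero) p
... | inj₁ j = zero , j
... | inj₂ q with split (k ∘ suc) q
...   | i , j = suc i , j

split-join : ∀ {r} (k : Vector ℕ r) i j → split k (join k i j) ≡ (i , j)
split-join k zero    j rewrite splitAt-↑ˡ (k zero) j (∑ (k ∘ suc)) = ≡.refl
split-join k (suc i) j rewrite splitAt-↑ʳ (k zero) (∑ (k ∘ suc)) (join (k ∘ suc) i j)
  | split-join (k ∘ suc) i j = ≡.refl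

join-split : ∀ {r} (k : Vector ℕ r) p → join k (proj₁ (split k p)) (proj₂ (split k p)) ≡ p
join-split {suc r} k p with splitAt (k zero) p in eq
... | inj₁ j = splitAt⁻¹-↑ˡ eq
... | inj₂ q = ≡.trans (≡.cong (k zero ↑ʳ_) (join-split (k ∘ suc) q)) (splitAt⁻¹-↑ʳ eq)

-- Graph distance

module _ {n : ℕ} (G : Graph n) where
  open Graph G

  private
    V : ∀ {u v} → Walk G u v → _
    V = vertices G

  reverseOnto : ∀ {u v w} → Walk G u v → Walk G u w → Walk G v w
  reverseOnto []      q = q
  reverseOnto (e ∷ p) q = reverseOnto p (~-sym e ∷ q)

  -- Both walks start at `u`, and gluing them there merges two occurrences of `u` into one; the
  -- extra `u` on the left restores the balance.
  vertices-reverseOnto : ∀ {u v w} (p : Walk G u v) (q : Walk G u w) →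
                         u ∷ V (reverseOnto p q) ↭ V p ++ V q
  vertices-reverseOnto []      q = ↭-refl
  vertices-reverseOnto {u} (e ∷ p) q = prep u
    (drop-∷ (↭-trans (vertices-reverseOnto p (~-sym e ∷ q)) (shift _ (V p) (V q))))

  length-reverseOnto : ∀ {u v w} (p : Walk G u v) (q : Walk G u w) →
                       length G (reverseOnto p q) ≡ length G p ℕ.+ length G q
  length-reverseOnto []      q = ≡.refl
  length-reverseOnto (e ∷ p) q =
    ≡.trans (length-reverseOnto p (~-sym e ∷ q)) (ℕ.+-suc (length G p) (length G q))

  -- Distances are minimal over paths, so the reversal must again have distinct vertices; this holds
  -- because its vertex list is a permutation of the old one.
  reversePath : ∀ {u v k} → PathOfLength G u v k → PathOfLength G v u k
  reversePath {u} ((p , unique) , ≡.refl) =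
    (reverseOnto p [] ,
     Permutation.Unique-resp-↭ (≡.setoid _) (↭⇒↭ₛ (↭-sym (drop-∷
       (↭-trans (vertices-reverseOnto p []) (++-comm (V p) (u ∷ [])))))) unique) ,
    ≡.trans (length-reverseOnto p []) (ℕ.+-identityʳ _)

  module _ (conn : Connected G) where

    dist-path : ∀ u v → PathOfLength G u v (dist G conn u v)
    dist-path u v = proj₁ (proj₂ (shortestPath G conn u v))

    dist-min : ∀ u v {k} → PathOfLength G u v k → dist G conn u v ℕ.≤ k
    dist-min u v = proj₂ (proj₂ (shortestPath G conn u v)) _

    dist-sym : ∀ u v → dist G conn u v ≡ dist G conn v u
    dist-sym u v = ℕ.≤-antisym (dist-min u v (reversePath (dist-path v u)))
                               (dist-min v u (reversePath (dist-path u v)))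

    dist-refl : ∀ u → dist G conn u u ≡ 0
    dist-refl u = ℕ.n≤0⇒n≡0 (dist-min u u (([] , All.[] AllPairs.∷ AllPairs.[]) , ≡.refl))

    dist≥1 : ∀ {u v} → u ≢ v → 1 ℕ.≤ dist G conn u v
    dist≥1 {u} {v} u≢v with dist G conn u v | dist-path u v
    ... | zero  | ([] , _) , _ = contradiction ≡.refl u≢v
    ... | suc _ | _            = s≤s z≤n

    dist≥2 : ∀ {u v} → u ≢ v → ¬ (u ~ v) → 2 ℕ.≤ dist G conn u v
    dist≥2 {u} {v} u≢v u≁v with dist G conn u v | dist-path u v
    ... | zero        | ([] , _) , _          = contradiction ≡.refl u≢v
    ... | suc zero    | ((e ∷ []) , _) , _    = contradiction e u≁v
    ... | suc (suc _) | _                     = s≤s (s≤s z≤n)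

    dist-edge : ∀ {u v} → u ≢ v → u ~ v → dist G conn u v ≡ 1
    dist-edge u≢v e = ℕ.≤-antisym
      (dist-min _ _ ((e ∷ [] , (u≢v All.∷ All.[]) AllPairs.∷ All.[] AllPairs.∷ AllPairs.[]) , ≡.refl))
      (dist≥1 u≢v)

    dist-common-neighbour : ∀ {u w v} → u ≢ v → ¬ (u ~ v) → u ~ w → w ~ v → dist G conn u v ≡ 2
    dist-common-neighbour u≢v u≁v e f = ℕ.≤-antisym
      (dist-min _ _ ((e ∷ f ∷ [] ,
        (flip ~-irrefl e All.∷ u≢v All.∷ All.[]) AllPairs.∷ (flip ~-irrefl f All.∷ All.[])
          AllPairs.∷ All.[] AllPairs.∷ AllPairs.[]) , ≡.refl))
      (dist≥2 u≢v u≁v)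

    module Excess {k} (c : Fin n → Fin k) (proper : IsProperColouring G c) where

      private
        d : Fin n → Fin n → ℕ
        d = dist G conn

      -- The loops do not affect the Laplacian and make d + loops ≥ joined hold
      -- on the diagonal, so the truncated subtraction is exact.
      loops joined excess : Fin n → Fin n → ℕ
      loops  u v = kronecker u v ℕ.+ kronecker u v
      joined u v = 1 ℕ.+ kronecker (c u) (c v)
      excess u v = d u v ℕ.+ loops u v ℕ.∸ joined u v

      -- On the diagonal the loops contribute 2. Distinct vertices of one colour are not adjacent,
      -- hence at distance at least 2; all other pairs need only distance 1.
      joined≤d+loops : ∀ u v → joined u v ℕ.≤ d u v ℕ.+ loops u v
      joined≤d+loops u v = helper (u ≟ v) (c u ≟ c v)
        where
        open ℕ.≤-Reasoning

        joined≡2 : c u ≡ c v → joined u v ≡ 2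
        joined≡2 = ≡.cong suc ∘ kronecker-≡

        helper : Dec (u ≡ v) → Dec (c u ≡ c v) → joined u v ℕ.≤ d u v ℕ.+ loops u v
        helper (yes u≡v) _ = begin
          joined u v              ≡⟨ joined≡2 (≡.cong c u≡v) ⟩
          2                       ≡⟨ ≡.cong₂ ℕ._+_ (kronecker-≡ u≡v) (kronecker-≡ u≡v) ⟨
          loops u v               ≤⟨ ℕ.m≤n+m _ (d u v) ⟩
          d u v ℕ.+ loops u v     ∎
        helper (no u≢v) (yes cu≡cv) = begin
          joined u v              ≡⟨ joined≡2 cu≡cv ⟩
          2                       ≤⟨ dist≥2 u≢v (λ e → proper e cu≡cv) ⟩
          d u v                   ≤⟨ ℕ.m≤m+n (d u v) (loops u v) ⟩
          d u v ℕ.+ loops u v     ∎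
        helper (no u≢v) (no cu≢cv) = begin
          joined u v              ≡⟨ ≡.cong suc (kronecker-≢ cu≢cv) ⟩
          1                       ≤⟨ dist≥1 u≢v ⟩
          d u v                   ≤⟨ ℕ.m≤m+n (d u v) (loops u v) ⟩
          d u v ℕ.+ loops u v     ∎

      excess-sym : ∀ u v → excess u v ≡ excess v u
      excess-sym u v = ≡.cong₂ ℕ._∸_
        (≡.cong₂ ℕ._+_ (dist-sym u v) (≡.cong₂ ℕ._+_ (kronecker-sym u v) (kronecker-sym u v)))
        (≡.cong (1 ℕ.+_) (kronecker-sym (c u) (c v)))

-- Ordered field

module OrderProperties {c ℓ₁ ℓ₂ ℓ₃} (ℝ : RealNumbers c ℓ₁ ℓ₂ ℓ₃) where
  open RealNumbers ℝ hiding (zero)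
  open HeytingProperties heytingCommutativeRing public
  open IsStrictPartialOrder <-isStrictPartialOrder public
    using (<-respʳ-≈; <-respˡ-≈) renaming (irrefl to <-irrefl; trans to <-trans)
  open CommutativeRing commutativeRing public using (ring; +-monoid; *-commutativeSemigroup)
  open CommutativeSemigroupProperties *-commutativeSemigroup public using (x∙yz≈y∙xz)
  open RingProperties ring public
    using (-‿distribˡ-*; -‿distribʳ-*; x[y-z]≈xy-xz; [y-z]x≈yx-zx; -0#≈0#; -‿involutive
          ; x∙y⁻¹≈ε⇒x≈y; x≈y⇒x∙y⁻¹≈ε; ⁻¹-anti-homo‿-; -‿+-comm
          ; xyx⁻¹≈y; +-inverseˡ-unique; //-rightDividesʳ)

  <⇒# : ∀ {x y} → x < y → x # y
  <⇒# = Equivalence.from (#⇔<⊎> _ _) ∘ inj₁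

  #⇒<⊎> : ∀ {x y} → x # y → x < y ⊎ y < x
  #⇒<⊎> = Equivalence.to (#⇔<⊎> _ _)

  -- Replaces case distinctions on the order, which the axioms do not decide: apartness passes to
  -- one of `x # z` and `z # y`, and a comparison in the unwanted direction is repaired by
  -- transitivity.
  <-cotrans : ∀ {x y} → x < y → ∀ z → x < z ⊎ z < y
  <-cotrans x<y z with #-cotrans (<⇒# x<y) z
  <-cotrans x<y z | inj₁ x#z with #⇒<⊎> x#z
  ... | inj₁ x<z = inj₁ x<z
  ... | inj₂ z<x = inj₂ (<-trans z<x x<y)
  <-cotrans x<y z | inj₂ z#y with #⇒<⊎> z#y
  ... | inj₁ z<y = inj₂ z<y
  ... | inj₂ y<z = inj₁ (<-trans x<y y<z)

  <⇒≤ : ∀ {x y} → x < y → x ≤ y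
  <⇒≤ x<y y<x = <-irrefl refl (<-trans x<y y<x)

  ≤-reflexive : ∀ {x y} → x ≈ y → x ≤ y
  ≤-reflexive x≈y = <-irrefl (sym x≈y)

  ≤-trans : ∀ {x y z} → x ≤ y → y ≤ z → x ≤ z
  ≤-trans {y = y} x≤y y≤z z<x with <-cotrans z<x y
  ... | inj₁ z<y = y≤z z<y
  ... | inj₂ y<x = x≤y y<x

  <-≤-trans : ∀ {x y z} → x < y → y ≤ z → x < z
  <-≤-trans {z = z} x<y y≤z with <-cotrans x<y z
  ... | inj₁ x<z = x<z
  ... | inj₂ z<y = contradiction z<y y≤z

  ≤-respʳ-≈ : ∀ {x y z} → y ≈ z → x ≤ y → x ≤ z
  ≤-respʳ-≈ y≈z x≤y = x≤y ∘ <-respˡ-≈ (sym y≈z)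

  ≤-respˡ-≈ : ∀ {x y z} → y ≈ z → y ≤ x → z ≤ x
  ≤-respˡ-≈ y≈z y≤x = y≤x ∘ <-respʳ-≈ (sym y≈z)

  +-monoʳ-< : ∀ {x y} z → x < y → z + x < z + y
  +-monoʳ-< z x<y = <-respˡ-≈ (+-comm _ z) (<-respʳ-≈ (+-comm _ z) (+-monoˡ-< z x<y))

  +-cancelʳ-< : ∀ {x y} z → x + z < y + z → x < y
  +-cancelʳ-< {x} {y} z = <-respˡ-≈ (//-rightDividesʳ z x) ∘ <-respʳ-≈ (//-rightDividesʳ z y) ∘ +-monoˡ-< (- z)

  +-monoˡ-≤ : ∀ {x y} z → x ≤ y → x + z ≤ y + z
  +-monoˡ-≤ z x≤y = x≤y ∘ +-cancelʳ-< z

  +-monoʳ-≤ : ∀ {x y} z → x ≤ y → z + x ≤ z + y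
  +-monoʳ-≤ z x≤y = ≤-respˡ-≈ (+-comm _ z) (≤-respʳ-≈ (+-comm _ z) (+-monoˡ-≤ z x≤y))

  +-mono-≤ : ∀ {w x y z} → w ≤ x → y ≤ z → w + y ≤ x + z
  +-mono-≤ w≤x y≤z = ≤-trans (+-monoˡ-≤ _ w≤x) (+-monoʳ-≤ _ y≤z)

  +-mono-<-≤ : ∀ {w x y z} → w < x → y ≤ z → w + y < x + z
  +-mono-<-≤ w<x y≤z = <-≤-trans (+-monoˡ-< _ w<x) (+-monoʳ-≤ _ y≤z)

  0<y-x : ∀ {x y} → x < y → 0# < y - x
  0<y-x {x} x<y = <-respˡ-≈ (-‿inverseʳ x) (+-monoˡ-< (- x) x<y)

  x<0⇒0<-x : ∀ {x} → x < 0# → 0# < - x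
  x<0⇒0<-x x<0 = <-respʳ-≈ (+-identityˡ _) (0<y-x x<0)

  x#0⇒0<x*x : ∀ {x} → x # 0# → 0# < x * x
  x#0⇒0<x*x {x} x#0 with #⇒<⊎> x#0
  ... | inj₂ 0<x = *-pos 0<x 0<x
  ... | inj₁ x<0 = <-respʳ-≈
    (trans (sym (-‿distribˡ-* x _)) (trans (-‿cong (sym (-‿distribʳ-* x x))) (-‿involutive _)))
    (*-pos (x<0⇒0<-x x<0) (x<0⇒0<-x x<0))

  -- An inverse of the product, multiplied by one factor, inverts the other. `x-0≈x` enters because
  -- apartness means invertibility of the difference.
  #0-factors : ∀ {x y} → x * y # 0# → x # 0# × y # 0#
  #0-factors {x} {y} xy#0 with #⇒invertible xy#0
  ... | z , z*xy≈1 , _ =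
    invertibleʳ⇒# (y * z , trans (*-congʳ (x-0≈x x)) (trans (sym (*-assoc x y z)) xyz≈1)) ,
    invertibleʳ⇒# (x * z , trans (*-congʳ (x-0≈x y)) (trans (sym (*-assoc y x z)) (trans (*-congʳ (*-comm y x)) xyz≈1)))
    where
    xyz≈1 : x * y * z ≈ 1#
    xyz≈1 = trans (*-comm _ z) (trans (*-congˡ (sym (x-0≈x _))) z*xy≈1)

  -- The sign of `x` is not decidable, but a negative square is apart from 0, hence so is `x`, and
  -- then the square is positive.
  0≤x*x : ∀ x → 0# ≤ x * x
  0≤x*x x x*x<0 = <-irrefl refl (<-trans x*x<0 (x#0⇒0<x*x (proj₁ (#0-factors (<⇒# x*x<0)))))

  *-nonneg : ∀ {x y} → 0# ≤ x → 0# ≤ y → 0# ≤ x * y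
  *-nonneg 0≤x 0≤y xy<0 with #0-factors (<⇒# xy<0)
  ... | x#0 , y#0 with #⇒<⊎> x#0 | #⇒<⊎> y#0
  ... | inj₁ x<0 | _        = 0≤x x<0
  ... | inj₂ _   | inj₁ y<0 = 0≤y y<0
  ... | inj₂ 0<x | inj₂ 0<y = <-irrefl refl (<-trans xy<0 (*-pos 0<x 0<y))

  *-monoˡ-< : ∀ {x y z} → 0# < z → x < y → x * z < y * z
  *-monoˡ-< {x} {y} {z} 0<z x<y = <-respˡ-≈ (+-identityˡ _) (<-respʳ-≈ eq (+-monoˡ-< (x * z) (*-pos (0<y-x x<y) 0<z)))
    where
    eq : (y - x) * z + x * z ≈ y * z
    eq = trans (sym (distribʳ z _ x)) (*-congʳ (trans (+-assoc y _ x) (trans (+-congˡ (-‿inverseˡ x)) (+-identityʳ y))))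

  *-monoˡ-≤ : ∀ {x y z} → 0# ≤ z → x ≤ y → x * z ≤ y * z
  *-monoˡ-≤ {x} {y} {z} 0≤z x≤y yz<xz =
    *-nonneg 0≤x-y 0≤z (<-respˡ-≈ (sym ([y-z]x≈yx-zx z y x)) (<-respʳ-≈ (-‿inverseʳ _) (+-monoˡ-< (- (x * z)) yz<xz)))
    where
    0≤x-y : 0# ≤ y - x
    0≤x-y = ≤-respˡ-≈ (-‿inverseʳ x) (+-monoˡ-≤ (- x) x≤y)

  #0-inverse : ∀ {x} → x # 0# → ∃[ z ] x * z ≈ 1#
  #0-inverse {x} x#0 with #⇒invertible x#0
  ... | z , _ , xz≈1 = z , trans (*-congʳ (sym (x-0≈x x))) xz≈1

  #0-cancel : ∀ {x y} → x # 0# → x * y ≈ 0# → y ≈ 0#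
  #0-cancel {x} {y} x#0 xy≈0 with #0-inverse x#0
  ... | z , xz≈1 = begin
    y              ≈⟨ *-identityʳ y ⟨
    y * 1#         ≈⟨ *-congˡ xz≈1 ⟨
    y * (x * z)    ≈⟨ *-assoc y x z ⟨
    y * x * z      ≈⟨ *-congʳ (trans (*-comm y x) xy≈0) ⟩
    0# * z         ≈⟨ zeroˡ z ⟩
    0#             ∎
    where open SetoidReasoning setoid

  #⇒-#0 : ∀ {x y} → x # y → x - y # 0#
  #⇒-#0 x#y with #⇒invertible x#y
  ... | z , zx≈1 , _ = invertibleˡ⇒# (z , trans (*-congˡ (x-0≈x _)) zx≈1)

  #0-cancel-≈ : ∀ {x y z} → x # 0# → x * y ≈ x * z → y ≈ z
  #0-cancel-≈ {x} {y} {z} x#0 xy≈xz =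
    x∙y⁻¹≈ε⇒x≈y y z (#0-cancel x#0 (trans (x[y-z]≈xy-xz x y z) (x≈y⇒x∙y⁻¹≈ε xy≈xz)))

  0<1 : 0# < 1#
  0<1 = <-respʳ-≈ (*-identityˡ 1#) (x#0⇒0<x*x 1#0)

  0≤fromℕ : ∀ n → 0# ≤ fromℕ n
  0≤fromℕ zero    = <-irrefl refl
  0≤fromℕ (suc n) = ≤-respˡ-≈ (+-identityˡ 0#) (+-mono-≤ (<⇒≤ 0<1) (0≤fromℕ n))

  fromℕ-+ : ∀ m n → fromℕ (m ℕ.+ n) ≈ fromℕ m + fromℕ n
  fromℕ-+ = Mult.×-homo-+ +-monoid 1#

  0<fromℕ : ∀ n → 0# < fromℕ (suc n)
  0<fromℕ n = <-respˡ-≈ (+-identityˡ 0#) (+-mono-<-≤ 0<1 (0≤fromℕ n))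

  n<n+2 : ∀ n → fromℕ n < fromℕ (n ℕ.+ 2)
  n<n+2 n = <-respˡ-≈ (+-identityʳ _) (<-respʳ-≈ (sym (fromℕ-+ n 2)) (+-monoʳ-< (fromℕ n) (0<fromℕ 1)))

-- Finite sums and linear systems

module SumOrder {c ℓ₁ ℓ₂ ℓ₃} (ℝ : RealNumbers c ℓ₁ ℓ₂ ℓ₃) where
  open RealNumbers ℝ hiding (zero)
  open OrderProperties ℝ
  open SumProperties semiring public
    using (sum-cong-≋; sum-remove; sum-replicate; sum-replicate-zero; ∑-distrib-+; ∑-comm
          ; *-distribˡ-sum; *-distribʳ-sum)
  open SetoidReasoning setoid

  sum-zero : ∀ {n} {f : Vector Carrier n} → (∀ i → f i ≈ 0#) → sum f ≈ 0#
  sum-zero {n} f≈0 = trans (sum-cong-≋ f≈0) (sum-replicate-zero n)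

  sum-single : ∀ {n} (f : Vector Carrier n) i → (∀ j → i ≢ j → f j ≈ 0#) → sum f ≈ f i
  sum-single {suc n} f i f≈0 = begin
    sum f                       ≈⟨ sum-remove f ⟩
    f i + sum (removeAt f i)    ≈⟨ +-congˡ (sum-zero λ j → f≈0 (punchIn i j) (punchInᵢ≢i i j ∘ ≡.sym)) ⟩
    f i + 0#                    ≈⟨ +-identityʳ (f i) ⟩
    f i                         ∎

  sum-neg : ∀ {n} (f : Vector Carrier n) → sum (λ i → - f i) ≈ - sum f
  sum-neg {zero}  f = sym -0#≈0#
  sum-neg {suc n} f = trans (+-congˡ (sum-neg (f ∘ suc))) (-‿+-comm _ _)

  sum-minus : ∀ {n} (f g : Vector Carrier n) → sum (λ i → f i - g i) ≈ sum f - sum g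
  sum-minus f g = trans (∑-distrib-+ f (λ i → - g i)) (+-congˡ (sum-neg g))

  sum-mono-≤ : ∀ {n} {f g : Vector Carrier n} → (∀ i → f i ≤ g i) → sum f ≤ sum g
  sum-mono-≤ {zero}  f≤g = <-irrefl refl
  sum-mono-≤ {suc n} f≤g = +-mono-≤ (f≤g zero) (sum-mono-≤ (f≤g ∘ suc))

  sum-mono-< : ∀ {n} {f g : Vector Carrier n} → (∀ i → f i ≤ g i) → ∀ i → f i < g i → sum f < sum g
  sum-mono-< {suc n} {f} {g} f≤g i fi<gi =
    <-respˡ-≈ (sym (sum-remove f)) (<-respʳ-≈ (sym (sum-remove g))
      (+-mono-<-≤ fi<gi (sum-mono-≤ (f≤g ∘ punchIn i))))

  sum-nonneg : ∀ {n} {f : Vector Carrier n} → (∀ i → 0# ≤ f i) → 0# ≤ sum f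
  sum-nonneg {n} 0≤f = ≤-respˡ-≈ (sum-replicate-zero n) (sum-mono-≤ 0≤f)

  term≤sum : ∀ {n} {f : Vector Carrier n} → (∀ i → 0# ≤ f i) → ∀ i → f i ≤ sum f
  term≤sum {suc n} {f} 0≤f i = ≤-respʳ-≈ (sym (sum-remove f)) (≤-respˡ-≈ (+-identityʳ (f i))
    (+-monoʳ-≤ (f i) (sum-nonneg (0≤f ∘ punchIn i))))

  two-terms≤sum : ∀ {n} {f : Vector Carrier n} → (∀ i → 0# ≤ f i) → ∀ {i j} → i ≢ j → f i + f j ≤ sum f
  two-terms≤sum {suc n} {f} 0≤f {i} i≢j = ≤-respʳ-≈ (sym (sum-remove f))
    (+-monoʳ-≤ (f i) (≤-respˡ-≈ (reflexive (≡.cong f (punchIn-punchOut i≢j)))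
      (term≤sum (0≤f ∘ punchIn i) (punchOut i≢j))))

  fromℕ-cong : ∀ {m n} → m ≡ n → fromℕ m ≈ fromℕ n
  fromℕ-cong = reflexive ∘ ≡.cong fromℕ

  fromℕ-1 : fromℕ 1 ≈ 1#
  fromℕ-1 = +-identityʳ 1#

  kronecker-* : ∀ {k} {i j : Fin k} → i ≡ j → ∀ x → fromℕ (kronecker i j) * x ≈ x
  kronecker-* i≡j x = trans (*-congʳ (trans (fromℕ-cong (kronecker-≡ i≡j)) fromℕ-1)) (*-identityˡ x)

  kronecker-*-≢ : ∀ {k} {i j : Fin k} → i ≢ j → ∀ x → fromℕ (kronecker i j) * x ≈ 0#
  kronecker-*-≢ i≢j x = trans (*-congʳ (fromℕ-cong (kronecker-≢ i≢j))) (zeroˡ x)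

  -- Allows a quantity that depends only on the class to be pulled out of a sum over that class.
  kronecker-*-cong : ∀ {k} (i j : Fin k) (f : Vector Carrier k) →
                     fromℕ (kronecker i j) * f j ≈ fromℕ (kronecker i j) * f i
  kronecker-*-cong i j f with i ≟ j
  ... | yes ≡.refl = refl
  ... | no _       = trans (zeroˡ (f j)) (sym (zeroˡ (f i)))

  sum-kronecker : ∀ {k} (i : Fin k) (f : Vector Carrier k) →
                  sum (λ j → fromℕ (kronecker i j) * f j) ≈ f i
  sum-kronecker i f = trans (sum-single _ i λ j i≢j → kronecker-*-≢ i≢j (f j)) (kronecker-* {i = i} ≡.refl (f i))

  sum-splitAt : ∀ m {n} (f : Vector Carrier (m ℕ.+ n)) →
                sum f ≈ sum (λ i → f (i ↑ˡ n)) + sum (λ i → f (m ↑ʳ i))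
  sum-splitAt zero    f = sym (+-identityˡ _)
  sum-splitAt (suc m) f = trans (+-congˡ (sum-splitAt m (f ∘ suc))) (sym (+-assoc _ _ _))

  sum-join : ∀ {r} (k : Vector ℕ r) (f : Vector Carrier (∑ k)) →
             sum f ≈ sum (λ i → sum (λ j → f (join k i j)))
  sum-join {zero}  k f = refl
  sum-join {suc r} k f = trans (sum-splitAt (k zero) f) (+-congˡ (sum-join (k ∘ suc) (λ q → f (k zero ↑ʳ q))))

  combine-rows : ∀ {n} (f g a : Vector Carrier n) x y →
    sum (λ j → f j * (x * a j)) - y * sum (λ j → g j * a j) ≈ sum (λ j → (f j * x - y * g j) * a j)
  combine-rows f g a x y = begin
    sum (λ j → f j * (x * a j)) - y * sum (λ j → g j * a j)
      ≈⟨ +-cong (sum-cong-≋ λ j → *-assoc (f j) x (a j))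
           (-‿cong (trans (sum-cong-≋ λ j → *-assoc y (g j) (a j)) (sym (*-distribˡ-sum y (λ j → g j * a j))))) ⟨
    sum (λ j → f j * x * a j) - sum (λ j → y * g j * a j)
      ≈⟨ sum-minus (λ j → f j * x * a j) (λ j → y * g j * a j) ⟨
    sum (λ j → f j * x * a j - y * g j * a j)
      ≈⟨ sum-cong-≋ (λ j → [y-z]x≈yx-zx (a j) (f j * x) (y * g j)) ⟨
    sum (λ j → (f j * x - y * g j) * a j) ∎

  -- Gaussian elimination, phrased contrapositively so that no pivot has to
  -- be found: if an entry of the first row were apart from 0, eliminating
  -- with it would give a smaller counterexample, so the row vanishes.
  more-unknowns-than-equations : ∀ k m → k ℕ.< m → (A : Fin k → Fin m → Carrier) →
    ¬ (∀ (a : Vector Carrier m) → (∀ i → sum (λ j → A i j * a j) ≈ 0#) → ∀ j → a j ≈ 0#)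
  more-unknowns-than-equations zero (suc m) _ A trivial =
    <-irrefl (sym (trivial (λ _ → 1#) (λ ()) Fin.zero)) 0<1
  more-unknowns-than-equations (suc k) (suc (suc m)) (s≤s k<m) A trivial =
    more-unknowns-than-equations k (suc (suc m)) (ℕ.m≤n⇒m≤1+n k<m) (A ∘ suc) λ a sol → trivial a λ where
      zero    → sum-zero {suc (suc m)} λ j → trans (*-congʳ (row₀≈0 j)) (zeroˡ (a j))
      (suc i) → sol i
    where
    row₀≈0 : ∀ p → A zero p ≈ 0#
    row₀≈0 p = proj₁ (tight _ _) λ π#0 → more-unknowns-than-equations k (suc m) k<m A′
      λ a′ sol → λ j → #0-cancel π#0 (lifted-trivial a′ sol j)
      where
      π = A zero p

      -- Cross multiplication with the pivot avoids division; column `p` is dropped.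
      A′ : Fin k → Fin (suc m) → Carrier
      A′ i j = A (suc i) (punchIn p j) * π - A (suc i) p * A zero (punchIn p j)

      module _ (a′ : Vector Carrier (suc m)) (sol : ∀ i → sum (λ j → A′ i j * a′ j) ≈ 0#) where
        s = sum (λ j → A zero (punchIn p j) * a′ j)

        -- Lifts a solution of the reduced system: scaling by `π` lets the coordinate at `p` be
        -- `- s`, which solves the first row without dividing.
        a : Vector Carrier (suc (suc m))
        a q with p ≟ q
        ... | yes _  = - s
        ... | no p≢q = π * a′ (punchOut p≢q)

        a-p : a p ≈ - s
        a-p with p ≟ p
        ... | yes _  = refl
        ... | no p≢p = contradiction ≡.refl p≢p

        a-punchIn : ∀ j → a (punchIn p j) ≈ π * a′ j
        a-punchIn j with p ≟ punchIn p j
        ... | yes p≡ = contradiction (≡.sym p≡) (punchInᵢ≢i p j)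
        ... | no p≢  = *-congˡ (reflexive (≡.cong a′ (punchOut-punchIn p)))

        evaluate : ∀ (r : Vector Carrier (suc (suc m))) →
          sum (λ q → r q * a q) ≈ sum (λ j → (r (punchIn p j) * π - r p * A zero (punchIn p j)) * a′ j)
        evaluate r = begin
          sum (λ q → r q * a q)
            ≈⟨ sum-remove {suc m} {p} (λ q → r q * a q) ⟩
          r p * a p + sum (λ j → r (punchIn p j) * a (punchIn p j))
            ≈⟨ +-comm _ _ ⟩
          sum (λ j → r (punchIn p j) * a (punchIn p j)) + r p * a p
            ≈⟨ +-cong (sum-cong-≋ {suc m} λ j → *-congˡ {r (punchIn p j)} (a-punchIn j))
                 (trans (*-congˡ a-p) (sym (-‿distribʳ-* _ _))) ⟩
          sum (λ j → r (punchIn p j) * (π * a′ j)) - r p * s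
            ≈⟨ combine-rows (r ∘ punchIn p) (A zero ∘ punchIn p) a′ π (r p) ⟩
          sum (λ j → (r (punchIn p j) * π - r p * A zero (punchIn p j)) * a′ j) ∎

        lifted-trivial : ∀ j → π * a′ j ≈ 0#
        lifted-trivial j = trans (sym (a-punchIn j)) (trivial a solves (punchIn p j))
          where
          solves : ∀ i → sum (λ q → A i q * a q) ≈ 0#
          solves zero    = trans (evaluate (A zero)) (sum-zero {suc m} λ j →
            trans (*-congʳ (trans (+-congʳ (*-comm (A zero (punchIn p j)) π)) (-‿inverseʳ _))) (zeroˡ (a′ j)))
          solves (suc i) = trans (evaluate (A (suc i))) (sol i)

-- Symmetric matrices

module SymmetricMatrices {c ℓ₁ ℓ₂ ℓ₃} (ℝ : RealNumbers c ℓ₁ ℓ₂ ℓ₃) where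
  open RealNumbers ℝ hiding (zero)
  open OrderProperties ℝ
  open SumOrder ℝ
  open Spectral ℝ
  open SetoidReasoning setoid

  dot : ∀ {n} → Vector Carrier n → Vector Carrier n → Carrier
  dot x y = sum (λ i → x i * y i)

  total : ∀ {n r} → (Fin r → Vector Carrier n) → Vector Carrier n
  total y u = sum (λ i → y i u)

  dot-comm : ∀ {n} (x y : Vector Carrier n) → dot x y ≈ dot y x
  dot-comm x y = sum-cong-≋ λ i → *-comm (x i) (y i)

  dot-congʳ : ∀ {n} (x : Vector Carrier n) {y z} → y ≋ z → dot x y ≈ dot x z
  dot-congʳ x y≋z = sum-cong-≋ λ i → *-congˡ (y≋z i)

  dot-• : ∀ {n} (x : Vector Carrier n) a y → dot x (a • y) ≈ a * dot x y
  dot-• x a y = begin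
    sum (λ i → x i * (a * y i))   ≈⟨ sum-cong-≋ (λ i → x∙yz≈y∙xz (x i) a (y i)) ⟩
    sum (λ i → a * (x i * y i))   ≈⟨ *-distribˡ-sum a (λ i → x i * y i) ⟨
    a * dot x y                   ∎

  0<dot : ∀ {n} (x : Vector Carrier n) u → x u # 0# → 0# < dot x x
  0<dot x u xu#0 = <-≤-trans (x#0⇒0<x*x xu#0) (term≤sum (λ v → 0≤x*x (x v)) u)

  dot-total : ∀ {n r} (x : Vector Carrier n) (y : Fin r → Vector Carrier n) →
              dot x (total y) ≈ sum (λ i → dot x (y i))
  dot-total x y = begin
    sum (λ u → x u * sum (λ i → y i u))     ≈⟨ sum-cong-≋ (λ u → *-distribˡ-sum (x u) (λ i → y i u)) ⟩
    sum (λ u → sum (λ i → x u * y i u))     ≈⟨ ∑-comm (λ u i → x u * y i u) ⟩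
    sum (λ i → sum (λ u → x u * y i u))     ∎

  IsSymmetric : ∀ {n} → Matrix n → Set _
  IsSymmetric M = ∀ i j → M i j ≈ M j i

  *ᵥ-selfAdjoint : ∀ {n} {M : Matrix n} → IsSymmetric M → ∀ x y → dot x (M *ᵥ y) ≈ dot (M *ᵥ x) y
  *ᵥ-selfAdjoint {M = M} M-sym x y = begin
    sum (λ i → x i * sum (λ j → M i j * y j))     ≈⟨ sum-cong-≋ (λ i → *-distribˡ-sum (x i) (λ j → M i j * y j)) ⟩
    sum (λ i → sum (λ j → x i * (M i j * y j)))   ≈⟨ ∑-comm (λ i j → x i * (M i j * y j)) ⟩
    sum (λ j → sum (λ i → x i * (M i j * y j)))   ≈⟨ sum-cong-≋ (λ j → sum-cong-≋ λ i → trans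
        (sym (*-assoc (x i) (M i j) (y j)))
        (*-congʳ (trans (*-comm (x i) (M i j)) (*-congʳ (M-sym i j))))) ⟩
    sum (λ j → sum (λ i → M j i * x i * y j))     ≈⟨ sum-cong-≋ (λ j → *-distribʳ-sum (y j) (λ i → M j i * x i)) ⟨
    sum (λ j → sum (λ i → M j i * x i) * y j)     ∎

  -- Self-adjointness makes `λ′ * dot x y` and `μ * dot x y` equal, and `λ′ - μ` can be cancelled.
  eigenvectors-orthogonal : ∀ {n} {M : Matrix n} → IsSymmetric M → ∀ {λ′ μ x y} → λ′ # μ →
    x ∈ Eigenspace M λ′ → y ∈ Eigenspace M μ → dot x y ≈ 0#
  eigenvectors-orthogonal {M = M} M-sym {λ′} {μ} {x} {y} λ#μ x∈ y∈ =
    #0-cancel (#⇒-#0 λ#μ) (trans ([y-z]x≈yx-zx (dot x y) λ′ μ) (x≈y⇒x∙y⁻¹≈ε (begin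
      λ′ * dot x y      ≈⟨ *-congˡ (dot-comm x y) ⟩
      λ′ * dot y x      ≈⟨ dot-• y λ′ x ⟨
      dot y (λ′ • x)    ≈⟨ dot-congʳ y x∈ ⟨
      dot y (M *ᵥ x)    ≈⟨ dot-comm y (M *ᵥ x) ⟩
      dot (M *ᵥ x) y    ≈⟨ *ᵥ-selfAdjoint M-sym x y ⟨
      dot x (M *ᵥ y)    ≈⟨ dot-congʳ x y∈ ⟩
      dot x (μ • y)     ≈⟨ dot-• x μ y ⟩
      μ * dot x y       ∎)))

  Eigenspace-combination : ∀ {n k} {M : Matrix n} {λ′} {b : Fin k → Vector Carrier n} →
    (∀ j → b j ∈ Eigenspace M λ′) → ∀ a → combination a b ∈ Eigenspace M λ′
  Eigenspace-combination {M = M} {λ′} {b} b∈ a u = begin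
    dot (M u) (total (λ j → a j • b j))     ≈⟨ dot-total (M u) (λ j → a j • b j) ⟩
    sum (λ j → dot (M u) (a j • b j))       ≈⟨ sum-cong-≋ (λ j → begin
      dot (M u) (a j • b j)                   ≈⟨ dot-• (M u) (a j) (b j) ⟩
      a j * dot (M u) (b j)                   ≈⟨ *-congˡ (b∈ j u) ⟩
      a j * (λ′ * b j u)                      ≈⟨ x∙yz≈y∙xz (a j) λ′ (b j u) ⟩
      λ′ * (a j * b j u)                      ∎) ⟩
    sum (λ j → λ′ * (a j * b j u))          ≈⟨ *-distribˡ-sum λ′ (λ j → a j * b j u) ⟨
    λ′ * combination a b u                  ∎

  module _ {n r} {M : Matrix n} (M-sym : IsSymmetric M) (ev : Vector Carrier r)
           (ev-distinct : ∀ i j → i ≢ j → ev i # ev j)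
           (y : Fin r → Vector Carrier n) (y∈ : ∀ i → y i ∈ Eigenspace M (ev i)) where

    private
      x : Vector Carrier n
      x = total y

      dot-x : ∀ i → dot x (y i) ≈ dot (y i) (y i)
      dot-x i = begin
        dot x (y i)                    ≈⟨ dot-comm x (y i) ⟩
        dot (y i) x                    ≈⟨ dot-total (y i) y ⟩
        sum (λ j → dot (y i) (y j))    ≈⟨ sum-single (λ j → dot (y i) (y j)) i (λ j i≢j →
                                            eigenvectors-orthogonal M-sym (ev-distinct i j i≢j) (y∈ i) (y∈ j)) ⟩
        dot (y i) (y i)                ∎

      form-*ᵥ : dot x (M *ᵥ x) ≈ sum (λ i → ev i * dot (y i) (y i))
      form-*ᵥ = begin
        dot x (M *ᵥ x)                        ≈⟨ dot-congʳ x (λ u → dot-total (M u) y) ⟩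
        dot x (total (λ i → M *ᵥ y i))        ≈⟨ dot-total x (λ i → M *ᵥ y i) ⟩
        sum (λ i → dot x (M *ᵥ y i))          ≈⟨ sum-cong-≋ (λ i → trans (dot-congʳ x (y∈ i))
                                                   (trans (dot-• x (ev i) (y i)) (*-congˡ (dot-x i)))) ⟩
        sum (λ i → ev i * dot (y i) (y i))    ∎

      form-scalar : ∀ β → β * dot x x ≈ sum (λ i → β * dot (y i) (y i))
      form-scalar β = trans
        (*-congˡ (trans (dot-total x y) (sum-cong-≋ dot-x)))
        (*-distribˡ-sum β (λ i → dot (y i) (y i)))

    -- By orthogonality both sides of the form inequality are sums of the `dot (y i) (y i)`,
    -- weighted by `β` and by `ev i`. An entry of some `y i` apart from 0 would make the second sum
    -- strictly smaller.
    low-eigenvectors-vanish : ∀ {β} → (∀ i → ev i < β) → β * dot (total y) (total y) ≤ dot (total y) (M *ᵥ total y) →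
                              ∀ i u → y i u ≈ 0#
    low-eigenvectors-vanish {β} ev<β β≤M i u = proj₁ (tight _ _) λ yiu#0 →
      ≤-respˡ-≈ (form-scalar β) (≤-respʳ-≈ form-*ᵥ β≤M)
        (sum-mono-< (λ j → *-monoˡ-≤ (sum-nonneg λ v → 0≤x*x (y j v)) (<⇒≤ (ev<β j))) i
          (*-monoˡ-< (0<dot (y i) u yiu#0) (ev<β i)))

-- Weighted Laplacians

module Laplacians {c ℓ₁ ℓ₂ ℓ₃} (ℝ : RealNumbers c ℓ₁ ℓ₂ ℓ₃) where
  open RealNumbers ℝ hiding (zero)
  open OrderProperties ℝ
  open SumOrder ℝ
  open Spectral ℝ
  open SymmetricMatrices ℝ
  open SetoidReasoning setoid

  -- The diagonal matrix of row sums minus `w`, written with differences so that diagonal weights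
  -- visibly contribute nothing. Natural weights are nonnegative by construction.
  laplacian : ∀ {n} → (Fin n → Fin n → ℕ) → Vector Carrier n → Vector Carrier n
  laplacian w x u = sum (λ v → fromℕ (w u v) * (x u - x v))

  laplacian-expand : ∀ {n} (w : Fin n → Fin n → ℕ) x u →
    laplacian w x u ≈ sum (λ v → fromℕ (w u v)) * x u - sum (λ v → fromℕ (w u v) * x v)
  laplacian-expand w x u = begin
    sum (λ v → fromℕ (w u v) * (x u - x v))
      ≈⟨ sum-cong-≋ (λ v → x[y-z]≈xy-xz (fromℕ (w u v)) (x u) (x v)) ⟩
    sum (λ v → fromℕ (w u v) * x u - fromℕ (w u v) * x v)
      ≈⟨ sum-minus (λ v → fromℕ (w u v) * x u) (λ v → fromℕ (w u v) * x v) ⟩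
    sum (λ v → fromℕ (w u v) * x u) - sum (λ v → fromℕ (w u v) * x v)
      ≈⟨ +-congʳ (*-distribʳ-sum (x u) (λ v → fromℕ (w u v))) ⟨
    sum (λ v → fromℕ (w u v)) * x u - sum (λ v → fromℕ (w u v) * x v) ∎

  laplacian-cong : ∀ {n} {w w′ : Fin n → Fin n → ℕ} → (∀ u v → w u v ≡ w′ u v) →
                   ∀ x u → laplacian w x u ≈ laplacian w′ x u
  laplacian-cong w≗w′ x u = sum-cong-≋ λ v → *-congʳ (fromℕ-cong (w≗w′ u v))

  laplacian-+ : ∀ {n} (w w′ : Fin n → Fin n → ℕ) x u →
    laplacian (λ u v → w u v ℕ.+ w′ u v) x u ≈ laplacian w x u + laplacian w′ x u
  laplacian-+ w w′ x u = trans
    (sum-cong-≋ λ v → trans (*-congʳ (fromℕ-+ (w u v) (w′ u v))) (distribʳ _ _ _))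
    (∑-distrib-+ (λ v → fromℕ (w u v) * (x u - x v)) (λ v → fromℕ (w′ u v) * (x u - x v)))

  laplacian-diagonal : ∀ {n} (w : Fin n → Fin n → ℕ) → (∀ {u v} → u ≢ v → w u v ≡ 0) →
                       ∀ x u → laplacian w x u ≈ 0#
  laplacian-diagonal w off-diagonal x u = sum-zero λ v → helper v
    where
    helper : ∀ v → fromℕ (w u v) * (x u - x v) ≈ 0#
    helper v with u ≟ v
    ... | yes ≡.refl = trans (*-congˡ (-‿inverseʳ (x u))) (zeroʳ _)
    ... | no u≢v     = trans (*-congʳ (fromℕ-cong (off-diagonal u≢v))) (zeroˡ _)

  -- Twice the quadratic form is ∑ w u v (x u - x v)², by exchanging u and v.
  laplacian-nonneg : ∀ {n} (w : Fin n → Fin n → ℕ) → (∀ u v → w u v ≡ w v u) →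
                     ∀ x → 0# ≤ dot x (laplacian w x)
  laplacian-nonneg {n} w w-sym x q<0 = 0≤q+q
    (<-respʳ-≈ (+-identityˡ 0#) (+-mono-<-≤ q<0 (<⇒≤ q<0)))
    where
    q = dot x (laplacian w x)

    t t′ : Fin n → Fin n → Carrier
    t  u v = fromℕ (w u v) * (x u * (x u - x v))
    t′ u v = fromℕ (w u v) * (x v * (x v - x u))

    q≈t : q ≈ sum (λ u → sum (λ v → t u v))
    q≈t = sum-cong-≋ λ u → trans (*-distribˡ-sum (x u) (λ v → fromℕ (w u v) * (x u - x v)))
      (sum-cong-≋ λ v → x∙yz≈y∙xz (x u) (fromℕ (w u v)) (x u - x v))

    q≈t′ : q ≈ sum (λ u → sum (λ v → t′ u v))
    q≈t′ = trans q≈t (trans (∑-comm t) (sum-cong-≋ λ v → sum-cong-≋ λ u → *-congʳ (fromℕ-cong (w-sym u v))))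

    t+t′ : ∀ u v → t u v + t′ u v ≈ fromℕ (w u v) * ((x u - x v) * (x u - x v))
    t+t′ u v = begin
      t u v + t′ u v
        ≈⟨ distribˡ (fromℕ (w u v)) (x u * (x u - x v)) (x v * (x v - x u)) ⟨
      fromℕ (w u v) * (x u * (x u - x v) + x v * (x v - x u))
        ≈⟨ *-congˡ (+-congˡ (trans (*-congˡ (sym (⁻¹-anti-homo‿- (x u) (x v))))
             (trans (sym (-‿distribʳ-* (x v) (x u - x v))) (-‿distribˡ-* (x v) (x u - x v))))) ⟩
      fromℕ (w u v) * (x u * (x u - x v) + - x v * (x u - x v))
        ≈⟨ *-congˡ (distribʳ (x u - x v) (x u) (- x v)) ⟨
      fromℕ (w u v) * ((x u - x v) * (x u - x v)) ∎

    0≤q+q : 0# ≤ q + q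
    0≤q+q = ≤-respʳ-≈ (begin
      sum (λ u → sum (λ v → fromℕ (w u v) * ((x u - x v) * (x u - x v))))
        ≈⟨ sum-cong-≋ (λ u → trans (sym (∑-distrib-+ (t u) (t′ u))) (sum-cong-≋ (t+t′ u))) ⟨
      sum (λ u → sum (t u) + sum (t′ u))
        ≈⟨ ∑-distrib-+ (λ u → sum (t u)) (λ u → sum (t′ u)) ⟩
      sum (λ u → sum (t u)) + sum (λ u → sum (t′ u))
        ≈⟨ +-cong q≈t q≈t′ ⟨
      q + q ∎)
      (sum-nonneg λ u → sum-nonneg λ v → *-nonneg (0≤fromℕ (w u v)) (0≤x*x (x u - x v)))

  -- Sizes and sums of colour classes.

  module _ {n k} (c : Fin n → Fin k) where

    classSize : Fin k → Carrier
    classSize j = sum (λ v → fromℕ (kronecker j (c v)))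

    classSum : Vector Carrier n → Fin k → Carrier
    classSum x j = sum (λ v → fromℕ (kronecker j (c v)) * x v)

    -- After exchanging the sums, each vertex is counted in exactly one class.
    sum-classSum : ∀ x → sum (classSum x) ≈ sum x
    sum-classSum x = trans (∑-comm λ j v → fromℕ (kronecker j (c v)) * x v) (sum-cong-≋ λ v → trans
      (sum-single (λ j → fromℕ (kronecker j (c v)) * x v) (c v) λ j cv≢j → kronecker-*-≢ (cv≢j ∘ ≡.sym) (x v))
      (kronecker-* {i = c v} ≡.refl (x v)))

    classSize≥1 : ∀ u → 1# ≤ classSize (c u)
    classSize≥1 u = ≤-respˡ-≈ (trans (fromℕ-cong (kronecker-≡ {i = c u} ≡.refl)) fromℕ-1)
      (term≤sum (λ v → 0≤fromℕ (kronecker (c u) (c v))) u)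

    classSize≥2 : ∀ {u v} → u ≢ v → c u ≡ c v → fromℕ 2 ≤ classSize (c u)
    classSize≥2 {u} {v} u≢v cu≡cv = ≤-respˡ-≈
      (trans (+-cong (indicator ≡.refl) (indicator cu≡cv)) (+-congˡ (sym fromℕ-1)))
      (two-terms≤sum (λ v → 0≤fromℕ (kronecker (c u) (c v))) u≢v)
      where
      indicator : ∀ {v} → c u ≡ c v → fromℕ (kronecker (c u) (c v)) ≈ 1#
      indicator eq = trans (sym (*-identityʳ _)) (kronecker-* eq 1#)

    -- A finite search decides whether another vertex shares the colour of `u`. If so, the class has
    -- size at least 2; if not, the class sum is `x u` itself, and both sides are 0.
    classSum≈0⇒2x²≤size·x² : ∀ x u → classSum x (c u) ≈ 0# →
      fromℕ 2 * (x u * x u) ≤ classSize (c u) * (x u * x u)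
    classSum≈0⇒2x²≤size·x² x u sum≈0 with any? (λ v → ¬? (u ≟ v) ×-dec (c u ≟ c v))
    ... | yes (v , u≢v , cu≡cv) = *-monoˡ-≤ (0≤x*x (x u)) (classSize≥2 u≢v cu≡cv)
    ... | no alone = ≤-reflexive (trans (vanish _) (sym (vanish _)))
      where
      xu≈0 : x u ≈ 0#
      xu≈0 = begin
        x u                                      ≈⟨ kronecker-* {i = c u} ≡.refl (x u) ⟨
        fromℕ (kronecker (c u) (c u)) * x u      ≈⟨ sum-single (λ v → fromℕ (kronecker (c u) (c v)) * x v) u (λ v u≢v →
                                                     kronecker-*-≢ (λ cu≡cv → alone (v , u≢v , cu≡cv)) (x v)) ⟨
        classSum x (c u)                         ≈⟨ sum≈0 ⟩
        0#                                       ∎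

      vanish : ∀ a → a * (x u * x u) ≈ 0#
      vanish a = trans (*-congˡ (trans (*-congʳ xu≈0) (zeroˡ (x u)))) (zeroʳ a)

-- The distance Laplacian

module DistanceLaplacian {c ℓ₁ ℓ₂ ℓ₃} (ℝ : RealNumbers c ℓ₁ ℓ₂ ℓ₃) {n : ℕ} (G : Graph n) (conn : Connected G) where
  open Graph G
  open RealNumbers ℝ hiding (zero)
  open OrderProperties ℝ
  open SumOrder ℝ
  open Spectral ℝ
  open SymmetricMatrices ℝ
  open Laplacians ℝ
  open SetoidReasoning setoid

  d : Fin n → Fin n → ℕ
  d = dist G conn

  D : Matrix n
  D = distanceLaplacian G conn

  diag-refl : ∀ t u → diag G conn t u u ≈ t u
  diag-refl t u with u ≟ u
  ... | yes _  = refl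
  ... | no u≢u = contradiction ≡.refl u≢u

  diag-≢ : ∀ t {u v} → u ≢ v → diag G conn t u v ≈ 0#
  diag-≢ t {u} {v} u≢v with u ≟ v
  ... | yes u≡v = contradiction u≡v u≢v
  ... | no _    = refl

  D-sym : IsSymmetric D
  D-sym u v = +-cong (helper (u ≟ v)) (-‿cong (fromℕ-cong (dist-sym G conn u v)))
    where
    t = transmission G conn
    helper : Dec (u ≡ v) → diag G conn t u v ≈ diag G conn t v u
    helper (yes ≡.refl) = refl
    helper (no u≢v)     = trans (diag-≢ t u≢v) (sym (diag-≢ t (u≢v ∘ ≡.sym)))

  D-laplacian : ∀ x u → (D *ᵥ x) u ≈ laplacian d x u
  D-laplacian x u = begin
    sum (λ v → (diag G conn t u v - fromℕ (d u v)) * x v)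
      ≈⟨ sum-cong-≋ (λ v → [y-z]x≈yx-zx (x v) (diag G conn t u v) (fromℕ (d u v))) ⟩
    sum (λ v → diag G conn t u v * x v - fromℕ (d u v) * x v)
      ≈⟨ sum-minus (λ v → diag G conn t u v * x v) (λ v → fromℕ (d u v) * x v) ⟩
    sum (λ v → diag G conn t u v * x v) - sum (λ v → fromℕ (d u v) * x v)
      ≈⟨ +-congʳ (begin
           sum (λ v → diag G conn t u v * x v)
             ≈⟨ sum-single (λ v → diag G conn t u v * x v) u (λ v u≢v → trans (*-congʳ (diag-≢ t u≢v)) (zeroˡ (x v))) ⟩
           diag G conn t u u * x u
             ≈⟨ *-congʳ (diag-refl t u) ⟩
           sum (λ v → fromℕ (d v u)) * x u
             -- `transmission` sums a column of the distance matrix, the Laplacian a row.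
             ≈⟨ *-congʳ (sum-cong-≋ λ v → fromℕ-cong (dist-sym G conn v u)) ⟩
           sum (λ v → fromℕ (d u v)) * x u ∎) ⟩
    sum (λ v → fromℕ (d u v)) * x u - sum (λ v → fromℕ (d u v) * x v)
      ≈⟨ laplacian-expand d x u ⟨
    laplacian d x u ∎
    where t = transmission G conn

  1ᵥ : Vector Carrier n
  1ᵥ _ = 1#

  1ᵥ∈Eigenspace-0 : 1ᵥ ∈ Eigenspace D 0#
  1ᵥ∈Eigenspace-0 u = trans (D-laplacian 1ᵥ u) (trans
    (sum-zero λ v → trans (*-congˡ (-‿inverseʳ 1#)) (zeroʳ (fromℕ (d u v))))
    (sym (zeroˡ 1#)))

  -- The sum is the inner product with `1ᵥ`, an eigenvector for 0.
  eigenvector-sum≈0 : ∀ {μ x} → μ # 0# → x ∈ Eigenspace D μ → sum x ≈ 0#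
  eigenvector-sum≈0 {x = x} μ#0 x∈ = trans (sum-cong-≋ λ v → sym (*-identityʳ (x v)))
    (eigenvectors-orthogonal D-sym μ#0 x∈ 1ᵥ∈Eigenspace-0)

  -- Decomposition of the distance Laplacian along a proper colouring.

  module Coloured {k} (c : Fin n → Fin k) (proper : IsProperColouring G c) where

    open Excess G conn c proper

    -- `joined` is the sum of the weights of a complete graph and of a disjoint union of cliques on
    -- the colour classes, each with loops.
    laplacian-joined : ∀ x u → laplacian joined x u ≈
      (fromℕ n * x u - sum x) + (classSize c (c u) * x u - classSum c x (c u))
    laplacian-joined x u = trans (laplacian-+ (λ _ _ → 1) (λ u v → kronecker (c u) (c v)) x u) (+-cong
      (trans (laplacian-expand (λ _ _ → 1) x u) (+-cong
        (*-congʳ (trans (sum-cong-≋ {n} λ _ → fromℕ-1) (sum-replicate n)))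
        (-‿cong (sum-cong-≋ λ v → trans (*-congʳ fromℕ-1) (*-identityˡ (x v))))))
      (laplacian-expand (λ u v → kronecker (c u) (c v)) x u))

    -- Loops have Laplacian 0, so they can be added to `d`; the result splits exactly into `joined`
    -- and `excess`.
    D-decomposition : ∀ x u → (D *ᵥ x) u ≈
      (fromℕ n * x u - sum x) + (classSize c (c u) * x u - classSum c x (c u)) + laplacian excess x u
    D-decomposition x u = begin
      (D *ᵥ x) u
        ≈⟨ D-laplacian x u ⟩
      laplacian d x u
        ≈⟨ +-identityʳ _ ⟨
      laplacian d x u + 0#
        ≈⟨ +-congˡ (laplacian-diagonal loops
             (λ u≢v → ≡.cong₂ ℕ._+_ (kronecker-≢ u≢v) (kronecker-≢ u≢v)) x u) ⟨
      laplacian d x u + laplacian loops x u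
        ≈⟨ laplacian-+ d loops x u ⟨
      laplacian (λ u v → d u v ℕ.+ loops u v) x u
        ≈⟨ laplacian-cong (λ u v → ≡.sym (ℕ.m+[n∸m]≡n (joined≤d+loops u v))) x u ⟩
      laplacian (λ u v → joined u v ℕ.+ excess u v) x u
        ≈⟨ laplacian-+ joined excess x u ⟩
      laplacian joined x u + laplacian excess x u
        ≈⟨ +-congʳ (laplacian-joined x u) ⟩
      (fromℕ n * x u - sum x) + (classSize c (c u) * x u - classSum c x (c u)) + laplacian excess x u ∎

    module _ (x : Vector Carrier n) (sums≈0 : ∀ j → classSum c x j ≈ 0#) where

      private
        z = fromℕ n
        s = λ u → classSize c (c u)

        total≈0 : sum x ≈ 0#
        total≈0 = trans (sym (sum-classSum c x)) (sum-zero sums≈0)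

        minus-0 : ∀ a {b} → b ≈ 0# → a - b ≈ a
        minus-0 a b≈0 = trans (+-congˡ (-‿cong b≈0)) (x-0≈x a)

        form : dot x (D *ᵥ x) ≈ sum (λ u → (z + s u) * (x u * x u)) + dot x (laplacian excess x)
        form = begin
          sum (λ u → x u * (D *ᵥ x) u)
            ≈⟨ sum-cong-≋ (λ u → begin
                 x u * (D *ᵥ x) u
                   ≈⟨ *-congˡ (trans (D-decomposition x u) (+-congʳ (trans
                        (+-cong (minus-0 (z * x u) total≈0) (minus-0 (s u * x u) (sums≈0 (c u))))
                        (sym (distribʳ (x u) z (s u)))))) ⟩
                 x u * ((z + s u) * x u + laplacian excess x u)
                   ≈⟨ trans (distribˡ (x u) ((z + s u) * x u) (laplacian excess x u))
                        (+-congʳ (x∙yz≈y∙xz (x u) (z + s u) (x u))) ⟩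
                 (z + s u) * (x u * x u) + x u * laplacian excess x u ∎) ⟩
          sum (λ u → (z + s u) * (x u * x u) + x u * laplacian excess x u)
            ≈⟨ ∑-distrib-+ (λ u → (z + s u) * (x u * x u)) (λ u → x u * laplacian excess x u) ⟩
          sum (λ u → (z + s u) * (x u * x u)) + dot x (laplacian excess x) ∎

      -- The sums drop out of the decomposition, leaving the weights `z + s u` on the squares and
      -- the nonnegative form of `excess`. Term by term, `s u` may be replaced by 2.
      classSums≈0⇒form-bound : fromℕ (n ℕ.+ 2) * dot x x ≤ dot x (D *ᵥ x)
      classSums≈0⇒form-bound = ≤-respˡ-≈
        (sym (*-distribˡ-sum (fromℕ (n ℕ.+ 2)) (λ u → x u * x u)))
        (≤-respʳ-≈ (sym form) (≤-respˡ-≈ (+-identityʳ _)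
          (+-mono-≤ (sum-mono-≤ bound) (laplacian-nonneg excess excess-sym x))))
        where
        bound : ∀ u → fromℕ (n ℕ.+ 2) * (x u * x u) ≤ (z + s u) * (x u * x u)
        bound u = ≤-respˡ-≈ (trans (sym (distribʳ _ _ _)) (*-congʳ (sym (fromℕ-+ n 2))))
          (≤-respʳ-≈ (sym (distribʳ _ _ _))
            (+-monoʳ-≤ _ (classSum≈0⇒2x²≤size·x² c x u (sums≈0 (c u)))))

    -- On an eigenvector the form is `μ * dot x x`, which contradicts the form bound as soon as some
    -- entry is apart from 0.
    low-eigenvector-vanishes : ∀ {μ x} → x ∈ Eigenspace D μ → μ < fromℕ (n ℕ.+ 2) →
      (∀ j → classSum c x j ≈ 0#) → ∀ u → x u ≈ 0#
    low-eigenvector-vanishes {μ} {x} x∈ μ<n+2 sums≈0 u = proj₁ (tight _ _) λ xu#0 →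
      classSums≈0⇒form-bound x sums≈0
        (<-respˡ-≈ (sym (trans (dot-congʳ x x∈) (dot-• x μ x))) (*-monoˡ-< (0<dot x u xu#0) μ<n+2))

  -- Upper bound on the number of eigenvalues.

  module CountBound {k} (c : Fin n → Fin (suc k)) (proper : IsProperColouring G c) (0<n : 0# < fromℕ n) where
    open Coloured c proper

    -- The class sums add up to the total, so the condition for colour `zero` follows from the
    -- others. This saves one equation: `suc k` colours impose only `k`.
    classSums-from-rest : ∀ x → sum x ≈ 0# → (∀ j → classSum c x (suc j) ≈ 0#) → ∀ j → classSum c x j ≈ 0#
    classSums-from-rest x total≈0 rest≈0 (suc j) = rest≈0 j
    classSums-from-rest x total≈0 rest≈0 zero    = begin
      classSum c x zero                                          ≈⟨ +-identityʳ _ ⟨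
      classSum c x zero + 0#                                     ≈⟨ +-congˡ (sum-zero rest≈0) ⟨
      classSum c x zero + sum (λ j → classSum c x (suc j))       ≈⟨ sum-classSum c x ⟩
      sum x                                                      ≈⟨ total≈0 ⟩
      0#                                                         ∎

    module _ {r} (ev : Vector Carrier r) (mult : Vector ℕ r)
             (ev-distinct : ∀ i j → i ≢ j → ev i # ev j)
             (ev∈ : ∀ i → ev i ∈ [ fromℕ n , fromℕ (n ℕ.+ 2) ⟩)
             (basis : ∀ i → HasMultiplicity D (ev i) (mult i)) where

      private
        b : ∀ i → Fin (mult i) → Vector Carrier n
        b i = proj₁ (basis i)

        -- The bases of all listed eigenspaces, as one family.
        B : Fin (∑ mult) → Vector Carrier n
        B p = b (proj₁ (split mult p)) (proj₂ (split mult p))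

        B-join : ∀ i j u → B (join mult i j) u ≡ b i j u
        B-join i j u = ≡.cong (λ ij → b (proj₁ ij) (proj₂ ij) u) (split-join mult i j)

      module _ (a : Vector Carrier (∑ mult)) where

        -- The component in the `i`-th eigenspace of the combination of `B` with coefficients `a`.
        part-of : Fin r → Vector Carrier n
        part-of i = combination (λ j → a (join mult i j)) (b i)

        part-of∈ : ∀ i → part-of i ∈ Eigenspace D (ev i)
        part-of∈ i = Eigenspace-combination (proj₁ (proj₂ (basis i))) (λ j → a (join mult i j))

        -- Every listed eigenvalue is at least `fromℕ n`, hence apart from 0, so each component sums
        -- to 0.
        sum-total : sum (total part-of) ≈ 0#
        sum-total = trans (∑-comm λ u i → part-of i u) (sum-zero λ i →
          eigenvector-sum≈0 (#-sym (<⇒# (<-≤-trans 0<n (proj₁ (ev∈ i))))) (part-of∈ i))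

        total≈combination : total part-of ≋ combination a B
        total≈combination u = trans
          (sum-cong-≋ λ i → sum-cong-≋ λ j → *-congˡ (reflexive (≡.sym (B-join i j u))))
          (sym (sum-join mult λ p → a p * B p u))

        classSum-total : ∀ j → classSum c (total part-of) j ≈ sum (λ p → classSum c (B p) j * a p)
        classSum-total j = begin
          dot w (total part-of)                     ≈⟨ dot-congʳ w total≈combination ⟩
          dot w (total (λ p → a p • B p))           ≈⟨ dot-total w (λ p → a p • B p) ⟩
          sum (λ p → dot w (a p • B p))             ≈⟨ sum-cong-≋ (λ p → trans (dot-• w (a p) (B p)) (*-comm (a p) (dot w (B p)))) ⟩
          sum (λ p → classSum c (B p) j * a p)      ∎
          where
          w : Vector Carrier n
          w v = fromℕ (kronecker j (c v))

        -- The `k` equations make all class sums of the combination vanish, so the form bound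
        -- applies and every eigenspace component is 0. Independence of each single basis then kills
        -- the coefficients.
        coefficients-vanish : (∀ i → sum (λ p → classSum c (B p) (suc i) * a p) ≈ 0#) → ∀ p → a p ≈ 0#
        coefficients-vanish sol p = trans (reflexive (≡.cong a (≡.sym (join-split mult p))))
          (proj₁ (proj₂ (proj₂ (basis i))) (λ j → a (join mult i j))
            (low-eigenvectors-vanish D-sym ev ev-distinct part-of part-of∈ (λ i → proj₂ (ev∈ i))
              (classSums≈0⇒form-bound (total part-of)
                (classSums-from-rest (total part-of) sum-total λ j → trans (classSum-total (suc j)) (sol j)))
              i)
            (proj₂ (split mult p)))
          where i = proj₁ (split mult p)

      -- Otherwise the `k` equations for `∑ mult` unknowns could not have only the trivial solution.
      multiplicities≤k : ∑ mult ℕ.≤ k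
      multiplicities≤k = ℕ.≮⇒≥ λ k<m →
        more-unknowns-than-equations k (∑ mult) k<m (λ i p → classSum c (B p) (suc i)) coefficients-vanish

  -- Spectrum of complete multipartite graphs in the interval.

  module CompleteMultipartite {k} (part : Fin n → Fin (suc k)) (rep : Fin (suc k) → Fin n)
      (part-rep : ∀ j → part (rep j) ≡ j) (adjacent : ∀ u v → (u ~ v) ⇔ (part u ≢ part v))
      (0<n : 0# < fromℕ n) where

    proper : IsProperColouring G part
    proper = Equivalence.to (adjacent _ _)

    open Excess G conn part proper
    open Coloured part proper
    open CountBound part proper 0<n using (classSums-from-rest)

    private
      ν : Carrier
      ν = fromℕ n

      N : Fin (suc k) → Carrier
      N = classSize part

      S : Vector Carrier n → Fin (suc k) → Carrier
      S = classSum part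

    -- The lower bound behind `joined≤d+loops` is attained: distances are 1 between parts and 2
    -- between distinct vertices of one part.
    d-multipartite : ∀ u v → d u v ℕ.+ loops u v ≡ joined u v
    d-multipartite u v = helper (u ≟ v) (part u ≟ part v)
      where
      helper : Dec (u ≡ v) → Dec (part u ≡ part v) → d u v ℕ.+ loops u v ≡ joined u v
      helper (yes ≡.refl) _ = ≡.trans
        (≡.cong₂ ℕ._+_ (dist-refl G conn u) (≡.cong₂ ℕ._+_ (kronecker-≡ {i = u} ≡.refl) (kronecker-≡ {i = u} ≡.refl)))
        (≡.cong suc (≡.sym (kronecker-≡ {i = part u} ≡.refl)))
      helper (no u≢v) (no pu≢pv) = ≡.trans
        (≡.cong₂ ℕ._+_ (dist-edge G conn u≢v (Equivalence.from (adjacent u v) pu≢pv))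
          (≡.cong₂ ℕ._+_ (kronecker-≢ u≢v) (kronecker-≢ u≢v)))
        (≡.cong suc (≡.sym (kronecker-≢ pu≢pv)))
      helper (no u≢v) (yes pu≡pv) = ≡.trans
        (≡.cong₂ ℕ._+_ (two-steps (proj₁ (conn u v))) (≡.cong₂ ℕ._+_ (kronecker-≢ u≢v) (kronecker-≢ u≢v)))
        (≡.cong suc (≡.sym (kronecker-≡ pu≡pv)))
        where
        -- Connectedness supplies a neighbour `w` of `u`. It lies outside the common part of `u` and
        -- `v`, so it is also adjacent to `v`.
        two-steps : Walk G u v → d u v ≡ 2
        two-steps []                = contradiction ≡.refl u≢v
        two-steps (_∷_ {w = w} e _) = dist-common-neighbour G conn u≢v (λ u~v → proper u~v pu≡pv) e
          (Equivalence.from (adjacent w v) λ pw≡pv → proper e (≡.trans pu≡pv (≡.sym pw≡pv)))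

    -- Since `d-multipartite` is an equality, `excess` is 0 and its Laplacian disappears.
    D-multipartite : ∀ x → sum x ≈ 0# → ∀ u → (D *ᵥ x) u ≈ ν * x u + (N (part u) * x u - S x (part u))
    D-multipartite x total≈0 u = begin
      (D *ᵥ x) u
        ≈⟨ D-decomposition x u ⟩
      (ν * x u - sum x) + (N (part u) * x u - S x (part u)) + laplacian excess x u
        ≈⟨ +-congˡ (laplacian-diagonal excess
             (λ {v} {w} _ → ≡.trans (≡.cong (ℕ._∸ joined v w) (d-multipartite v w)) (ℕ.n∸n≡0 (joined v w))) x u) ⟩
      (ν * x u - sum x) + (N (part u) * x u - S x (part u)) + 0#
        ≈⟨ +-identityʳ _ ⟩
      (ν * x u - sum x) + (N (part u) * x u - S x (part u))
        ≈⟨ +-congʳ (trans (+-congˡ (-‿cong total≈0)) (x-0≈x _)) ⟩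
      ν * x u + (N (part u) * x u - S x (part u)) ∎

    eigenvector-equation : ∀ {μ x} → μ # 0# → x ∈ Eigenspace D μ → ∀ u →
      (μ - ν) * x u ≈ N (part u) * x u - S x (part u)
    eigenvector-equation {μ} {x} μ#0 x∈ u = begin
      (μ - ν) * x u
        ≈⟨ [y-z]x≈yx-zx (x u) μ ν ⟩
      μ * x u - ν * x u
        ≈⟨ +-congʳ (trans (sym (x∈ u)) (D-multipartite x (eigenvector-sum≈0 μ#0 x∈) u)) ⟩
      ν * x u + (N (part u) * x u - S x (part u)) - ν * x u
        ≈⟨ xyx⁻¹≈y (ν * x u) _ ⟩
      N (part u) * x u - S x (part u) ∎

    ν#0 : ν # 0#
    ν#0 = #-sym (<⇒# 0<n)

    N#0 : ∀ u → N (part u) # 0#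
    N#0 u = #-sym (<⇒# (<-≤-trans 0<1 (classSize≥1 part u)))

    -- Summing `eigenvector-equation` over part `j` gives `N j * S x j` twice with opposite signs on
    -- the right, and `μ - ν` can be cancelled on the left.
    classSums-vanish : ∀ {μ x} → μ # 0# → μ # ν → x ∈ Eigenspace D μ → ∀ j → S x j ≈ 0#
    classSums-vanish {μ} {x} μ#0 μ#ν x∈ j = #0-cancel (#⇒-#0 μ#ν) (begin
      (μ - ν) * S x j
        ≈⟨ *-distribˡ-sum (μ - ν) (λ v → κ v * x v) ⟩
      sum (λ v → (μ - ν) * (κ v * x v))
        ≈⟨ sum-cong-≋ (λ v → trans (x∙yz≈y∙xz (μ - ν) (κ v) (x v)) (trans
             (*-congˡ (eigenvector-equation μ#0 x∈ v))
             (trans (kronecker-*-cong j (part v) (λ i → N i * x v - S x i))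
               (x[y-z]≈xy-xz (κ v) (N j * x v) (S x j))))) ⟩
      sum (λ v → κ v * (N j * x v) - κ v * S x j)
        ≈⟨ sum-minus (λ v → κ v * (N j * x v)) (λ v → κ v * S x j) ⟩
      sum (λ v → κ v * (N j * x v)) - sum (λ v → κ v * S x j)
        ≈⟨ +-cong (dot-• κ (N j) x) (-‿cong (sym (*-distribʳ-sum (S x j) κ))) ⟩
      N j * S x j - N j * S x j
        ≈⟨ -‿inverseʳ _ ⟩
      0# ∎)
      where
      κ : Vector Carrier n
      κ v = fromℕ (kronecker j (part v))

    -- If `μ` were apart from `ν`, the class sums of the eigenvector would vanish, and with them the
    -- eigenvector; tightness turns this refutation into equality.
    eigenvalue≈ν : ∀ {μ} → IsEigenvalue D μ → μ ∈ [ ν , fromℕ (n ℕ.+ 2) ⟩ → μ ≈ ν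
    eigenvalue≈ν (x , x∈ , i , xi#0) (ν≤μ , μ<n+2) = proj₁ (tight _ _) λ μ#ν →
      proj₂ (tight _ _) (low-eigenvector-vanishes x∈ μ<n+2
        (classSums-vanish (#-sym (<⇒# (<-≤-trans 0<n ν≤μ))) μ#ν x∈) i) xi#0

    classSum-∘part : ∀ f j → S (f ∘ part) j ≈ N j * f j
    classSum-∘part f j = trans (sum-cong-≋ λ v → kronecker-*-cong j (part v) f)
      (sym (*-distribʳ-sum (f j) (λ v → fromℕ (kronecker j (part v)))))

    sum-∘part : ∀ f → sum (f ∘ part) ≈ sum (λ j → N j * f j)
    sum-∘part f = trans (sym (sum-classSum part (f ∘ part))) (sum-cong-≋ (classSum-∘part f))

    ∘part∈Eigenspace : ∀ f → sum (λ j → N j * f j) ≈ 0# → (f ∘ part) ∈ Eigenspace D ν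
    ∘part∈Eigenspace f Nf≈0 u = begin
      (D *ᵥ (f ∘ part)) u
        ≈⟨ D-multipartite (f ∘ part) (trans (sum-∘part f) Nf≈0) u ⟩
      ν * f (part u) + (N (part u) * f (part u) - S (f ∘ part) (part u))
        ≈⟨ +-congˡ (trans (+-congˡ (-‿cong (classSum-∘part f (part u)))) (-‿inverseʳ _)) ⟩
      ν * f (part u) + 0#
        ≈⟨ +-identityʳ _ ⟩
      ν * f (part u) ∎

    N*eigenvector : ∀ {x} → x ∈ Eigenspace D ν → ∀ u → N (part u) * x u ≈ S x (part u)
    N*eigenvector {x} x∈ u = x∙y⁻¹≈ε⇒x≈y _ _ (begin
      N (part u) * x u - S x (part u)   ≈⟨ eigenvector-equation ν#0 x∈ u ⟨
      (ν - ν) * x u                     ≈⟨ *-congʳ (-‿inverseʳ ν) ⟩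
      0# * x u                          ≈⟨ zeroˡ (x u) ⟩
      0#                                ∎)

    -- `N (part u) * x u` is the class sum, which depends only on the part, and part sizes can be
    -- cancelled.
    eigenvector-constant : ∀ {x} → x ∈ Eigenspace D ν → ∀ u → x u ≈ x (rep (part u))
    eigenvector-constant {x} x∈ u = #0-cancel-≈ (N#0 u) (begin
      N (part u) * x u      ≈⟨ N*eigenvector x∈ u ⟩
      S x (part u)          ≈⟨ reflexive (≡.cong (S x) (part-rep (part u))) ⟨
      S x (part v)          ≈⟨ N*eigenvector x∈ v ⟨
      N (part v) * x v      ≈⟨ *-congʳ (reflexive (≡.cong N (part-rep (part u)))) ⟩
      N (part u) * x v      ∎)
      where v = rep (part u)

    private
      N₀#0 : N zero # 0#
      N₀#0 = ≡.subst (λ j → N j # 0#) (part-rep zero) (N#0 (rep zero))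

      N₀⁻¹ : Carrier
      N₀⁻¹ = proj₁ (#0-inverse N₀#0)

      N₀N₀⁻¹ : ∀ x → N zero * (x * N₀⁻¹) ≈ x
      N₀N₀⁻¹ x = trans (x∙yz≈y∙xz (N zero) x N₀⁻¹) (trans (*-congˡ (proj₂ (#0-inverse N₀#0))) (*-identityʳ x))

    -- β j ∘ part is the indicator of part j + 1, corrected on part 0 so that
    -- the entries sum to 0.
    β : Fin k → Fin (suc k) → Carrier
    β j zero    = - (N (suc j) * N₀⁻¹)
    β j (suc i) = fromℕ (kronecker j i)

    N*β≈0 : ∀ j → sum (λ i → N i * β j i) ≈ 0#
    N*β≈0 j = begin
      N zero * - (N (suc j) * N₀⁻¹) + sum (λ i → N (suc i) * fromℕ (kronecker j i))
        ≈⟨ +-cong (trans (sym (-‿distribʳ-* _ _)) (-‿cong (N₀N₀⁻¹ (N (suc j)))))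
             (trans (sum-cong-≋ λ i → *-comm (N (suc i)) (fromℕ (kronecker j i))) (sum-kronecker j (N ∘ suc))) ⟩
      - N (suc j) + N (suc j)
        ≈⟨ -‿inverseˡ _ ⟩
      0# ∎

    combination-suc : ∀ a i → sum (λ j → a j * β j (suc i)) ≈ a i
    combination-suc a i = trans
      (sum-cong-≋ λ j → trans (*-comm (a j) (fromℕ (kronecker j i))) (*-congʳ (fromℕ-cong (kronecker-sym j i))))
      (sum-kronecker i a)

    -- The coordinates are the values off part `zero`, where the `β j` are indicators. The value on
    -- part `zero` is then forced by the weighted sum, as `N zero` is apart from 0.
    combination-determined : ∀ (f : Vector Carrier (suc k)) → sum (λ i → N i * f i) ≈ 0# →
      ∀ i → f i ≈ sum (λ j → f (suc j) * β j i)
    combination-determined f Nf≈0 (suc i) = sym (combination-suc (f ∘ suc) i)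
    combination-determined f Nf≈0 zero    = #0-cancel-≈ N₀#0 (begin
      N zero * f zero
        ≈⟨ +-inverseˡ-unique _ _ Nf≈0 ⟩
      - sum (λ j → N (suc j) * f (suc j))
        ≈⟨ sum-neg (λ j → N (suc j) * f (suc j)) ⟨
      sum (λ j → - (N (suc j) * f (suc j)))
        ≈⟨ sum-cong-≋ (λ j → begin
             N zero * (f (suc j) * - (N (suc j) * N₀⁻¹))
               ≈⟨ x∙yz≈y∙xz (N zero) (f (suc j)) _ ⟩
             f (suc j) * (N zero * - (N (suc j) * N₀⁻¹))
               ≈⟨ *-congˡ (trans (sym (-‿distribʳ-* _ _)) (-‿cong (N₀N₀⁻¹ (N (suc j))))) ⟩
             f (suc j) * - N (suc j)
               ≈⟨ trans (sym (-‿distribʳ-* _ _)) (-‿cong (*-comm _ _)) ⟩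
             - (N (suc j) * f (suc j)) ∎) ⟨
      sum (λ j → N zero * (f (suc j) * β j zero))
        ≈⟨ *-distribˡ-sum (N zero) (λ j → f (suc j) * β j zero) ⟨
      N zero * sum (λ j → f (suc j) * β j zero) ∎)

    ν-multiplicity : HasMultiplicity D ν k
    ν-multiplicity = (λ j → β j ∘ part) ,
      (λ j → ∘part∈Eigenspace (β j) (N*β≈0 j)) ,
      -- Evaluating the relation at the representative of part `suc i` isolates the coefficient
      -- `a i`.
      (λ a a≈0 i → trans (sym (combination-suc a i))
        (≡.subst (λ p → sum (λ j → a j * β j p) ≈ 0#) (part-rep (suc i)) (a≈0 (rep (suc i))))) ,
      λ x x∈ → (λ j → x (rep (suc j))) , λ u → trans (eigenvector-constant x∈ u)
        (combination-determined (x ∘ rep) (begin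
          sum (λ j → N j * x (rep j))
            ≈⟨ sum-∘part (x ∘ rep) ⟨
          sum (λ v → x (rep (part v)))
            ≈⟨ sum-cong-≋ (eigenvector-constant x∈) ⟨
          sum x
            ≈⟨ eigenvector-sum≈0 ν#0 x∈ ⟩
          0# ∎) (part u))

    -- With a single part the only class sum is the total, which is 0 for an eigenvalue apart from
    -- 0; so the eigenvector would vanish.
    no-eigenvalue : k ≡ 0 → ∀ {μ} → IsEigenvalue D μ → ¬ (μ ∈ [ ν , fromℕ (n ℕ.+ 2) ⟩)
    no-eigenvalue ≡.refl (x , x∈ , i , xi#0) (ν≤μ , μ<n+2) =
      proj₂ (tight _ _) (low-eigenvector-vanishes x∈ μ<n+2
        (classSums-from-rest x (eigenvector-sum≈0 (#-sym (<⇒# (<-≤-trans 0<n ν≤μ))) x∈) λ ()) i) xi#0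

    -- An element of `Fin k` is a second part; its `β` takes the value 1 there.
    ν-isEigenvalue : Fin k → IsEigenvalue D ν
    ν-isEigenvalue j = β j ∘ part , ∘part∈Eigenspace (β j) (N*β≈0 j) , rep (suc j) ,
      #-congʳ (sym (trans (reflexive (≡.cong (β j) (part-rep (suc j))))
        (trans (fromℕ-cong (kronecker-≡ {i = j} ≡.refl)) fromℕ-1))) 1#0

  completeMultipartite-count : ∀ {k} (part : Fin n → Fin (suc k)) (rep : Fin (suc k) → Fin n) →
    (∀ j → part (rep j) ≡ j) → (∀ u v → (u ~ v) ⇔ (part u ≢ part v)) → 0# < fromℕ n →
    CountsEigenvalues D [ fromℕ n , fromℕ (n ℕ.+ 2) ⟩ k
  -- A listed eigenvalue needs a nonzero eigenvector, so multiplicity 0 is expressed by the empty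
  -- list.
  completeMultipartite-count {zero} part rep part-rep adjacent 0<n =
    0 , (λ ()) , (λ ()) , (λ ()) , (λ ()) ,
    (λ μ isEv μ∈ → contradiction μ∈ (no-eigenvalue ≡.refl isEv)) , (λ ()) , ≡.refl
    where open CompleteMultipartite part rep part-rep adjacent 0<n
  completeMultipartite-count {suc k} part rep part-rep adjacent 0<n =
    1 , (λ _ → fromℕ n) , (λ _ → suc k) ,
    (λ { zero zero 0≢0 → contradiction ≡.refl 0≢0 }) ,
    (λ _ → ν-isEigenvalue zero , ≤-reflexive refl , n<n+2 n) ,
    (λ μ isEv μ∈ → zero , eigenvalue≈ν isEv μ∈) ,
    (λ _ → ν-multiplicity) ,
    ≡.sym (ℕ.+-identityʳ (suc k))
    where open CompleteMultipartite part rep part-rep adjacent 0<n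

-- Chromatic number of complete multipartite graphs and conclusion.

multipartite-chromatic : ∀ {n k χ} {G : Graph n} (let open Graph G) (part : Fin n → Fin k) (rep : Fin k → Fin n) →
  (∀ j → part (rep j) ≡ j) → (∀ u v → (u ~ v) ⇔ (part u ≢ part v)) → IsChromaticNumber G χ → χ ≡ k
multipartite-chromatic part rep part-rep adjacent ((c , proper) , minimal) = ℕ.≤-antisym
  (minimal _ (part , Equivalence.to (adjacent _ _)))
  -- Representatives of distinct parts are pairwise adjacent, so any proper colouring separates
  -- them.
  (injective⇒≤ {f = c ∘ rep} λ {i} {j} same-colour → decidable-stable (i ≟ j) λ i≢j →
    proper (Equivalence.from (adjacent (rep i) (rep j)) λ pi≡pj →
      i≢j (≡.trans (≡.sym (part-rep i)) (≡.trans pi≡pj (part-rep j)))) same-colour)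

open import Data.Nat.Base using (ℕ; NonZero; _≤_; _+_; _∸_)

theorem2p6 : ∀ {c ℓ₁ ℓ₂ ℓ₃ : Level} (ℝ : RealNumbers c ℓ₁ ℓ₂ ℓ₃) →
    let open RealNumbers ℝ using (fromℕ)
        open Spectral ℝ in
    (n : ℕ) .{{_ : NonZero n}} (G : Graph n) (conn : Connected G) (χ : ℕ) → IsChromaticNumber G χ →
      (∀ m → CountsEigenvalues (distanceLaplacian G conn) [ fromℕ n , fromℕ (n + 2) ⟩ m → m ≤ χ ∸ 1)
      × (IsCompleteMultipartite G →
           CountsEigenvalues (distanceLaplacian G conn) [ fromℕ n , fromℕ (n + 2) ⟩ (χ ∸ 1))
-- A vertex needs a colour, so the chromatic number is a successor and `χ ∸ 1` does not truncate.
theorem2p6 ℝ (suc n) G conn zero ((c , _) , _) with () ← c zero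
theorem2p6 ℝ (suc n) G conn (suc χ) chromatic@((c , proper) , _) = upper , attained
  where
  open RealNumbers ℝ using (fromℕ; 0#; _<_)
  open Spectral ℝ

  0<n : 0# < fromℕ (suc n)
  0<n = OrderProperties.0<fromℕ ℝ n

  upper : ∀ m → CountsEigenvalues (distanceLaplacian G conn) [ fromℕ (suc n) , fromℕ (suc n + 2) ⟩ m → m ≤ χ
  upper _ (_ , ev , mult , distinct , inside , _ , basis , ≡.refl) =
    DistanceLaplacian.CountBound.multiplicities≤k ℝ G conn c proper 0<n ev mult distinct (proj₂ ∘ inside) basis

  attained : IsCompleteMultipartite G →
    CountsEigenvalues (distanceLaplacian G conn) [ fromℕ (suc n) , fromℕ (suc n + 2) ⟩ χ
  attained (k , part , surjective , adjacent)
    -- Identifies the number of parts with `suc χ`, so that the count for the multipartite graph is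
    -- `χ`.
    with ≡.refl ← multipartite-chromatic {G = G} part (proj₁ ∘ surjective) (λ j → proj₂ (surjective j) ≡.refl) adjacent chromatic =
    DistanceLaplacian.completeMultipartite-count ℝ G conn part (proj₁ ∘ surjective) (λ j → proj₂ (surjective j) ≡.refl) adjacent 0<n
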